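{- Let $p=p(n)\in[0,1]$ satisfy $p\gg n^{ -1}$, i.e. $n\,p(n)\to\infty$ as $n\to\infty$, and let $G\in\mathcal{G}(n,p)$. Then asymptotically almost surely the tree-width of $G$ satisfies $$\operatorname{tw}(G)=n-O\left(\sqrt{\frac{n}{p}}\right),$$ that is, there is a constant $C>0$ such that $\Pr\left(n-C\sqrt{n/p}\le \operatorname{tw}(G)\le n\right)\to 1$ as $n\to\infty$.
   Context: All graphs are finite and simple. $\mathcal{G}(n,p)$ is the Erdős–Rényi random graph on $n$ labeled vertices in which each pair of vertices is an edge independently with probability $p$. A property holds asymptotically almost surely (a.a.s.) if its probability tends to $1$ as $n\to\infty$. $\operatorname{tw}(G)$ denotes the usual tree-width of $G$ (the minimum over all tree decompositions of the maximum bag size minus one). -}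

module Defs where

open import Level using (Level; _⊔_; suc; 0ℓ)
open import Algebra.Apartness.Bundles using (HeytingField)
open import Algebra.Bundles using (CommutativeRing)
import Algebra.Definitions.RawMonoid as RawMonoidDefs
open import Data.Bool.Base using (Bool; true; false; if_then_else_; T)
open import Data.Empty using (⊥-elim)
open import Data.Fin.Base as Fin using (Fin; inject₁; fromℕ)
open import Data.Fin.Subset using (Subset; _∈_; ∣_∣; ⊤)
open import Data.Fin.Subset.Properties using (∈⊤)
open import Data.Nat.Base as ℕ using (ℕ; zero)
open import Data.Nat.Induction using (<-rec)
import Data.Nat.Properties as ℕₚ
open import Data.Product.Base using (∃; ∃-syntax; Σ-syntax; _×_; _,_; proj₁)
open import Data.Sum.Base using (_⊎_)
open import Data.Vec.Base using (Vec; []; _∷_; lookup)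
import Data.Vec.Functional as Vector
open import Function.Definitions using (Injective)
open import Relation.Binary.Construct.Closure.ReflexiveTransitive using (Star; ε)
open import Relation.Binary.Core using (Rel)
open import Relation.Binary.PropositionalEquality using (_≡_; refl)
open import Relation.Binary.Structures using (IsStrictPartialOrder)
open import Relation.Nullary.Negation using (¬_)

-- The library has no real numbers, so results are stated for an arbitrary
-- Cauchy complete Archimedean ordered field.  Classically this determines ℝ up
-- to isomorphism.  The axioms are phrased so that constructive reals satisfy
-- them too: the order is not assumed to be decidable.
record RealNumbers c ℓ₁ ℓ₂ : Set (suc (c ⊔ ℓ₁ ⊔ ℓ₂)) where
  field
    heytingField : HeytingField c ℓ₁ ℓ₂

  open HeytingField heytingField public
    hiding (refl; sym; trans; reflexive; isEquivalence)

  commutativeRing : CommutativeRing c ℓ₁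
  commutativeRing = record { isCommutativeRing = isCommutativeRing }

  open CommutativeRing commutativeRing public
    using (+-rawMonoid; refl; sym; trans; reflexive; isEquivalence)

  infix 4 _<_ _≤_ _⟶_

  field
    _<_                  : Rel Carrier ℓ₂
    isStrictPartialOrder : IsStrictPartialOrder _≈_ _<_
    #⇒<⊎>                : ∀ {x y} → x # y → x < y ⊎ y < x
    <⇒#                  : ∀ {x y} → x < y → x # y
    +-monoˡ-<            : ∀ {x y} z → x < y → x + z < y + z
    *-positive           : ∀ {x y} → 0# < x → 0# < y → 0# < x * y

  _≤_ : Rel Carrier ℓ₂
  x ≤ y = ¬ (y < x)

  fromNat : ℕ → Carrier
  fromNat n = RawMonoidDefs._×_ +-rawMonoid n 1#

  _⟶_ : (ℕ → Carrier) → Carrier → Set (c ⊔ ℓ₂)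
  x ⟶ l = ∀ ε → 0# < ε → ∃[ N ] ∀ n → N ℕ.≤ n → (l - ε < x n) × (x n < l + ε)

  _⟶∞ : (ℕ → Carrier) → Set (c ⊔ ℓ₂)
  x ⟶∞ = ∀ K → ∃[ N ] ∀ n → N ℕ.≤ n → K < x n

  Cauchy : (ℕ → Carrier) → Set (c ⊔ ℓ₂)
  Cauchy x = ∀ ε → 0# < ε →
             ∃[ N ] ∀ m n → N ℕ.≤ m → N ℕ.≤ n → x m < x n + ε

  field
    archimedean : ∀ x → ∃[ n ] x < fromNat n
    complete    : ∀ x → Cauchy x → ∃[ l ] x ⟶ l

    -- Square roots exist by completeness; making √ an operation only fixes
    -- notation.  On 0# ≤ x it is determined up to _≈_ by the two laws, and
    -- elsewhere its value is irrelevant.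
    √           : Carrier → Carrier
    √-nonneg    : ∀ {x} → 0# ≤ x → 0# ≤ √ x
    √-square    : ∀ {x} → 0# ≤ x → √ x * √ x ≈ x

  -- The library's inverse of an element apart from 0# is that of y - 0#.
  _÷_[_] : Carrier → (y : Carrier) → 0# < y → Carrier
  x ÷ y [ 0<y ] = x * proj₁ (#⇒invertible (#-sym (<⇒# 0<y)))

record Graph (n : ℕ) : Set where
  field
    adj        : Fin n → Fin n → Bool
    adj-sym    : ∀ i j → adj i j ≡ adj j i
    adj-irrefl : ∀ i → adj i i ≡ false

  Adj : Rel (Fin n) 0ℓ
  Adj i j = T (adj i j)

open Graph public

Connected : ∀ {m} → Graph m → Set
Connected {m} H = Fin m × (∀ x y → Star (Adj H) x y)

record Cycle {m} (H : Graph m) : Set where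
  field
    k        : ℕ
    vertex   : Fin (3 ℕ.+ k) → Fin m
    distinct : Injective _≡_ _≡_ vertex
    step     : ∀ (i : Fin (2 ℕ.+ k)) → Adj H (vertex (inject₁ i)) (vertex (Fin.suc i))
    close    : Adj H (vertex (fromℕ (2 ℕ.+ k))) (vertex Fin.zero)

IsTree : ∀ {m} → Graph m → Set
IsTree H = Connected H × ¬ Cycle H

record TreeDecomposition {n} (G : Graph n) : Set where
  field
    size         : ℕ
    tree         : Graph size
    isTree       : IsTree tree
    bag          : Fin size → Subset n
    coversVertex : ∀ v → ∃[ t ] v ∈ bag t
    coversEdge   : ∀ u v → Adj G u v → ∃[ t ] (u ∈ bag t × v ∈ bag t)
    -- The nodes whose bags contain v induce a connected subgraph of the tree.
    connected    : ∀ v s t → v ∈ bag s → v ∈ bag t →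
                   Star (λ a b → Adj tree a b × v ∈ bag a × v ∈ bag b) s t

  -- Truncated predecessor: this differs from "maximum minus one" only if all
  -- bags are empty, that is, only for the graph without vertices.
  width : ℕ
  width = ℕ.pred (Vector.foldr ℕ._⊔_ 0 (λ t → ∣ bag t ∣))

open TreeDecomposition public using (width)

IsTreeWidth : ∀ {n} → Graph n → ℕ → Set
IsTreeWidth G k = (Σ[ D ∈ TreeDecomposition G ] width D ≡ k)
                × (∀ (D : TreeDecomposition G) → k ℕ.≤ width D)

-- Tree-width is a well-defined number: it is unique, and (without assuming
-- excluded middle) it cannot fail to exist.
treeWidth-unique : ∀ {n} {G : Graph n} {k l} →
                   IsTreeWidth G k → IsTreeWidth G l → k ≡ l
treeWidth-unique ((D , refl) , min) ((E , refl) , min′) =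
  ℕₚ.≤-antisym (min E) (min′ D)

trivialDecomposition : ∀ {n} (G : Graph n) → TreeDecomposition G
trivialDecomposition G = record
  { size         = 1
  ; tree         = point
  ; isTree       = (Fin.zero , λ { Fin.zero Fin.zero → ε }) , λ C → Cycle.close C
  ; bag          = λ _ → ⊤
  ; coversVertex = λ _ → Fin.zero , ∈⊤
  ; coversEdge   = λ _ _ _ → Fin.zero , ∈⊤ , ∈⊤
  ; connected    = λ { _ Fin.zero Fin.zero _ _ → ε }
  }
  where
  point : Graph 1
  point = record
    { adj = λ _ _ → false ; adj-sym = λ _ _ → refl ; adj-irrefl = λ _ → refl }

treeWidth-exists : ∀ {n} (G : Graph n) → ¬ ¬ ∃ (IsTreeWidth G)
treeWidth-exists G none =
  <-rec (λ k → ¬ (Σ[ D ∈ TreeDecomposition G ] width D ≡ k)) step _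
        (trivialDecomposition G , refl)
  where
  step : ∀ k → (∀ {j} → j ℕ.< k → ¬ (Σ[ D ∈ TreeDecomposition G ] width D ≡ j)) →
         ¬ (Σ[ D ∈ TreeDecomposition G ] width D ≡ k)
  step k smaller D≡k =
    none (k , D≡k , λ E → ℕₚ.≮⇒≥ (λ E<k → smaller E<k (E , refl)))

-- One coin for each pair of distinct vertices: the row of vertex 0 holds the
-- coins of the pairs {0 , 1 + j}, the remaining rows those of the pairs
-- {1 + i , 1 + j}.
data Coins : ℕ → Set where
  []  : Coins 0
  _∷_ : ∀ {n} → Vec Bool n → Coins n → Coins (ℕ.suc n)

toGraph : ∀ {n} → Coins n → Graph n
toGraph ω = record { adj = a ω ; adj-sym = a-sym ω ; adj-irrefl = a-irrefl ω }
  where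
  a : ∀ {n} → Coins n → Fin n → Fin n → Bool
  a (r ∷ ω) Fin.zero    Fin.zero    = false
  a (r ∷ ω) Fin.zero    (Fin.suc j) = lookup r j
  a (r ∷ ω) (Fin.suc i) Fin.zero    = lookup r i
  a (r ∷ ω) (Fin.suc i) (Fin.suc j) = a ω i j

  a-sym : ∀ {n} (ω : Coins n) i j → a ω i j ≡ a ω j i
  a-sym (r ∷ ω) Fin.zero    Fin.zero    = refl
  a-sym (r ∷ ω) Fin.zero    (Fin.suc j) = refl
  a-sym (r ∷ ω) (Fin.suc i) Fin.zero    = refl
  a-sym (r ∷ ω) (Fin.suc i) (Fin.suc j) = a-sym ω i j

  a-irrefl : ∀ {n} (ω : Coins n) i → a ω i i ≡ false
  a-irrefl (r ∷ ω) Fin.zero    = refl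
  a-irrefl (r ∷ ω) (Fin.suc i) = a-irrefl ω i

module RandomGraph {c ℓ₁ ℓ₂} (ℝ : RealNumbers c ℓ₁ ℓ₂) where
  open RealNumbers ℝ

  -- Expectation over m independent coins, each true with probability p.
  𝔼-row : Carrier → (m : ℕ) → (Vec Bool m → Carrier) → Carrier
  𝔼-row p zero      f = f []
  𝔼-row p (ℕ.suc m) f = p        * 𝔼-row p m (λ r → f (true  ∷ r))
                      + (1# - p) * 𝔼-row p m (λ r → f (false ∷ r))

  𝔼 : Carrier → (n : ℕ) → (Coins n → Carrier) → Carrier
  𝔼 p zero      f = f []
  𝔼 p (ℕ.suc n) f = 𝔼-row p n (λ r → 𝔼 p n (λ ω → f (r ∷ ω)))

  -- The probability of the event A in 𝒢(n , p).
  Pr : Carrier → (n : ℕ) → (Graph n → Bool) → Carrier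
  Pr p n A = 𝔼 p n (λ ω → if A (toGraph ω) then 1# else 0#)

  -- A sum over the graphs satisfying P needs P to be decidable, which is not
  -- available constructively for comparisons of reals.  So P is said to hold
  -- a.a.s. if it contains decidable events whose probabilities tend to 1; for
  -- decidable P (classically: always) this is equivalent to Pr P ⟶ 1.
  AAS : ∀ {ℓ} → (ℕ → Carrier) → (∀ n → Graph n → Set ℓ) → Set (c ⊔ ℓ₂ ⊔ ℓ)
  AAS p P = Σ[ A ∈ (∀ n → Graph n → Bool) ]
              (∀ n G → T (A n G) → P n G) × ((λ n → Pr (p n) n (A n)) ⟶ 1#)

-- With a ≈ √(5n/p), a union bound over the 3ⁿ ways of placing each vertex on
-- the left, on the right or nowhere shows that a.a.s. there are no disjoint
-- vertex sets of size a without an edge between them.  If all bags of a tree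
-- decomposition had at most n - 3a vertices, then from every node t of the tree
-- some neighbouring branch would contain a vertices outside the bag of t, since
-- otherwise the branches could be grouped into two large sets without an edge
-- between them.  Walking into these heavy branches one eventually turns back
-- over an edge of the tree, and the two heavy branches at its ends are again
-- such a pair of sets.  Hence the width is at least n - 3a.

module Submission where

open import Defs
open import Algebra.Apartness.Properties.HeytingCommutativeRing using (x-0≈x; 1#0)
open import Algebra.Bundles using (CommutativeRing)
import Algebra.Properties.CommutativeSemiring.Exp as Exp
import Algebra.Properties.Group as GroupProperties
import Algebra.Properties.Ring as RingProperties
import Algebra.Properties.Semiring.Exp as SemiringExp
import Algebra.Properties.Semiring.Mult as Mult
import Algebra.Solver.Ring.NaturalCoefficients.Default as NaturalSolver
open import Data.Bool.Base using (Bool; T; true; false; if_then_else_; not; _∧_; _∨_)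
open import Data.Bool.Properties using (T?; T-∧)
open import Data.Empty using (⊥; ⊥-elim)
open import Data.Fin.Base as Fin using (Fin; toℕ; inject₁; fromℕ; fromℕ<)
import Data.Fin.Properties as Finₚ
open import Data.Fin.Subset using (Subset; _∈_; _∉_; ∣_∣; ⊤)
open import Data.Fin.Subset.Properties using (_∈?_; drop-there; ∣p∣≤n)
open import Data.Nat.Base as ℕ using (ℕ; zero; suc; _≤ᵇ_; z≤n; s≤s)
open import Data.Nat.Induction using (<-wellFounded)
import Data.Nat.Properties as ℕₚ
open import Data.Nat.Tactic.RingSolver using (solve-∀)
open import Data.Product.Base using (∃-syntax; Σ-syntax; _×_; _,_; proj₁; proj₂)
open import Data.Sum.Base using (_⊎_; inj₁; inj₂; [_,_]′)
open import Data.Unit.Base using (tt)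
open import Data.Vec.Base using (Vec; []; _∷_; there; lookup; tabulate)
import Data.Vec.Functional as Vector
open import Data.Vec.Properties using (lookup∘tabulate)
open import Effect.Monad using (RawMonad)
open import Function.Base using (_∘_; id)
open import Function.Bundles using (Equivalence)
open import Function.Definitions using (Injective)
open import Induction.WellFounded using (Acc; acc)
open import Level using (Level)
open import Relation.Binary.Core using (Rel)
open import Relation.Binary.PropositionalEquality as ≡ using (_≡_; _≢_)
import Relation.Binary.Reasoning.Base.Triple as Triple
import Relation.Binary.Reasoning.Setoid as SetoidReasoning
open import Relation.Binary.Structures using (IsPreorder; IsStrictPartialOrder)
open import Relation.Nullary.Decidable
  using (Dec; yes; no; does; ¬?; _×-dec_; _⊎-dec_; ¬¬-excluded-middle)
open import Relation.Nullary.Negation using (¬_; ¬¬-Monad)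
open import Relation.Unary using (Pred; Decidable; U)
open import Relation.Unary.Properties using (U?; ∅?)

-- The loss is three times `a` for the following reason. At a node, take the branches in the order
-- of the indices of their first nodes, up to the one with which `a` vertices are reached. Fewer
-- than `a` vertices lie before this critical branch, and fewer than `a` after it, as otherwise the
-- two groups would form a separation; of `3a` vertices outside the bag, at least `a` are then left
-- for the critical branch itself. The other shaping force is constructive. Reachability in the tree
-- is assumed decidable only under a double negation, which a comparison of naturals tolerates.
-- Reals cannot be compared, so the number `m` is only placed between `5/p` and `7/p`. The event
-- required by `AAS` must be Boolean, so separations are found by a search through all labellings,
-- and the same search carries the union bound.

module TreeSeparations where
  open import Data.Nat.Base using (_≤_; _<_; _+_)
  open ≡ using (refl; sym; trans; cong; subst)
  open import Relation.Binary.Construct.Closure.ReflexiveTransitive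
    using (Star; ε; _◅_; _◅◅_; gmap; reverse)

  private variable
    ℓ ℓ′ ℓ″ : Level
    n : ℕ

  -- Sizes of decidable vertex sets

  count : {P : Pred (Fin n) ℓ} → Decidable P → ℕ
  count {n = zero}  P? = 0
  count {n = suc n} P? with does (P? Fin.zero)
  ... | true  = suc (count (P? ∘ Fin.suc))
  ... | false = count (P? ∘ Fin.suc)

  count-∪ : {P : Pred (Fin n) ℓ} {Q : Pred (Fin n) ℓ′} {R : Pred (Fin n) ℓ″}
            (P? : Decidable P) (Q? : Decidable Q) (R? : Decidable R) →
            (∀ {i} → P i → Q i ⊎ R i) → count P? ≤ count Q? + count R?
  count-∪ {n = zero}  P? Q? R? P⊆Q∪R = z≤n
  count-∪ {n = suc n} P? Q? R? P⊆Q∪R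
    with P? Fin.zero | Q? Fin.zero | R? Fin.zero
       | count-∪ (P? ∘ Fin.suc) (Q? ∘ Fin.suc) (R? ∘ Fin.suc) P⊆Q∪R
  ... | no _  | no _  | no _  | ih = ih
  ... | no _  | no _  | yes _ | ih = ℕₚ.≤-trans ih (ℕₚ.+-monoʳ-≤ _ (ℕₚ.n≤1+n _))
  ... | no _  | yes _ | no _  | ih = ℕₚ.m≤n⇒m≤1+n ih
  ... | no _  | yes _ | yes _ | ih =
    ℕₚ.m≤n⇒m≤1+n (ℕₚ.≤-trans ih (ℕₚ.+-monoʳ-≤ _ (ℕₚ.n≤1+n _)))
  ... | yes p | no ¬q | no ¬r | ih = ⊥-elim ([ ¬q , ¬r ]′ (P⊆Q∪R p))
  ... | yes _ | no _  | yes _ | ih = ℕₚ.≤-trans (s≤s ih) (ℕₚ.≤-reflexive (sym (ℕₚ.+-suc _ _)))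
  ... | yes _ | yes _ | no _  | ih = s≤s ih
  ... | yes _ | yes _ | yes _ | ih = s≤s (ℕₚ.≤-trans ih (ℕₚ.+-monoʳ-≤ _ (ℕₚ.n≤1+n _)))

  count-∅ : {P : Pred (Fin n) ℓ} (P? : Decidable P) → (∀ {i} → ¬ P i) → count P? ≡ 0
  count-∅ {n = zero}  P? ¬P = refl
  count-∅ {n = suc n} P? ¬P with P? Fin.zero
  ... | yes p = ⊥-elim (¬P p)
  ... | no _  = count-∅ (P? ∘ Fin.suc) ¬P

  count-⊆ : {P : Pred (Fin n) ℓ} {Q : Pred (Fin n) ℓ′}
            (P? : Decidable P) (Q? : Decidable Q) →
            (∀ {i} → P i → Q i) → count P? ≤ count Q?
  count-⊆ {n = n} P? Q? P⊆Q = ℕₚ.≤-trans (count-∪ P? Q? ∅? (inj₁ ∘ P⊆Q))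
    (ℕₚ.≤-reflexive (trans (cong (count Q? +_) (count-∅ {n = n} ∅? id)) (ℕₚ.+-identityʳ _)))

  count-⊂ : {P : Pred (Fin n) ℓ} {Q : Pred (Fin n) ℓ′}
            (P? : Decidable P) (Q? : Decidable Q) →
            (∀ {i} → P i → Q i) → ∀ i → ¬ P i → Q i → count P? < count Q?
  count-⊂ P? Q? P⊆Q Fin.zero ¬p q with P? Fin.zero | Q? Fin.zero
  ... | yes p | _     = ⊥-elim (¬p p)
  ... | no _  | no ¬q = ⊥-elim (¬q q)
  ... | no _  | yes _ = s≤s (count-⊆ (P? ∘ Fin.suc) (Q? ∘ Fin.suc) P⊆Q)
  count-⊂ P? Q? P⊆Q (Fin.suc i) ¬p q
    with P? Fin.zero | Q? Fin.zero | count-⊂ (P? ∘ Fin.suc) (Q? ∘ Fin.suc) P⊆Q i ¬p q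
  ... | yes _  | yes _ | ih = s≤s ih
  ... | yes p₀ | no ¬q | ih = ⊥-elim (¬q (P⊆Q p₀))
  ... | no _   | yes _ | ih = ℕₚ.m≤n⇒m≤1+n ih
  ... | no _   | no _  | ih = ih

  count-U : {P : Pred (Fin n) ℓ} (P? : Decidable P) → (∀ i → P i) → count P? ≡ n
  count-U {n = zero}  P? all = refl
  count-U {n = suc n} P? all with P? Fin.zero
  ... | yes _ = cong suc (count-U (P? ∘ Fin.suc) (all ∘ Fin.suc))
  ... | no ¬p = ⊥-elim (¬p (all Fin.zero))

  -- Bags are subsets, but branches of the tree are predicates; this makes their sizes comparable.
  count-∈ : (X : Subset n) → count (_∈? X) ≡ ∣ X ∣
  count-∈ []      = refl
  count-∈ (x ∷ X) =
    head x (ℕₚ.≤-antisym (count-⊆ tail? (_∈? X) drop-there) (count-⊆ (_∈? X) tail? there))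
    where
    tail? = λ i → Fin.suc i ∈? (x ∷ X)

    head : ∀ x → count (λ i → Fin.suc i ∈? (x ∷ X)) ≡ count (_∈? X) →
           count (_∈? (x ∷ X)) ≡ ∣ x ∷ X ∣
    head true  eq = cong suc (trans eq (count-∈ X))
    head false eq = trans eq (count-∈ X)

  crossing : (g : ℕ → ℕ) (a m : ℕ) → g 0 < a → a ≤ g m →
             ∃[ j ] (j < m × g j < a × a ≤ g (suc j))
  crossing g a zero    g0<a a≤gm = ⊥-elim (ℕₚ.<⇒≱ g0<a a≤gm)
  crossing g a (suc m) g0<a a≤gm with a ℕₚ.≤? g m
  ... | no a≰gm = m , ℕₚ.n<1+n m , ℕₚ.≰⇒> a≰gm , a≤gm
  ... | yes a≤gm′ with crossing g a m g0<a a≤gm′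
  ... | j , j<m , lo , hi = j , ℕₚ.m<n⇒m<1+n j<m , lo , hi

  -- Cycles

  record SimplePath {m} (E : Rel (Fin m) ℓ) (x y : Fin m) : Set ℓ where
    field
      len      : ℕ
      vertex   : Fin (suc len) → Fin m
      start    : vertex Fin.zero ≡ x
      end      : vertex (fromℕ len) ≡ y
      distinct : Injective _≡_ _≡_ vertex
      step     : ∀ i → E (vertex (inject₁ i)) (vertex (Fin.suc i))

  module _ {m} {E : Rel (Fin m) ℓ} where

    dropTo : ∀ {x y z} (π : SimplePath E x y) (i : Fin (suc (SimplePath.len π))) →
             SimplePath.vertex π i ≡ z → SimplePath E z y
    dropTo π Fin.zero πᵢ≡z = record
      { len = len ; vertex = vertex ; start = πᵢ≡z ; end = end ; distinct = distinct ; step = step }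
      where open SimplePath π
    dropTo record { len = suc l ; vertex = v ; end = e ; distinct = d ; step = s }
           (Fin.suc i) πᵢ≡z =
      dropTo
        (record { len = l ; vertex = v ∘ Fin.suc ; start = refl ; end = e
                ; distinct = Finₚ.suc-injective ∘ d ; step = s ∘ Fin.suc })
        i πᵢ≡z

    prepend : ∀ {x y z} → E x y → (π : SimplePath E y z) →
              (∀ i → SimplePath.vertex π i ≢ x) → SimplePath E x z
    prepend {x} Exy π fresh = record
      { len = suc len ; vertex = v ; start = refl ; end = end ; distinct = d _ _ ; step = s }
      where
      open SimplePath π
      v : Fin (suc (suc len)) → Fin m
      v Fin.zero    = x
      v (Fin.suc i) = vertex i
      d : ∀ i j → v i ≡ v j → i ≡ j
      d Fin.zero    Fin.zero    eq = refl
      d Fin.zero    (Fin.suc j) eq = ⊥-elim (fresh j (sym eq))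
      d (Fin.suc i) Fin.zero    eq = ⊥-elim (fresh i eq)
      d (Fin.suc i) (Fin.suc j) eq = cong Fin.suc (distinct eq)
      s : ∀ i → E (v (inject₁ i)) (v (Fin.suc i))
      s Fin.zero    = subst (E x) (sym start) Exy
      s (Fin.suc i) = step i

    -- Loop erasure: once the tail is simple, either `x` occurs on it and everything before that
    -- occurrence is dropped, or `x` can be put in front.
    simplify : ∀ {x y} → Star E x y → SimplePath E x y
    simplify {x} ε = record
      { len = 0 ; vertex = λ _ → x ; start = refl ; end = refl
      ; distinct = λ { {Fin.zero} {Fin.zero} _ → refl } ; step = λ () }
    simplify {x} (Exz ◅ walk) with simplify walk
    ... | π with Finₚ.any? (λ i → SimplePath.vertex π i Finₚ.≟ x)
    ... | yes (i , πᵢ≡x) = dropTo π i πᵢ≡x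
    ... | no  ∄i         = prepend Exz π (λ i πᵢ≡x → ∄i (i , πᵢ≡x))

  module _ {m} (H : Graph m) where

    adj-swap : ∀ {x y} → Adj H x y → Adj H y x
    adj-swap {x} {y} = subst T (adj-sym H x y)

    adj-distinct : ∀ {x y} → Adj H x y → x ≢ y
    adj-distinct {x} xx refl = subst T (adj-irrefl H x) xx

    Avoiding : Fin m → Rel (Fin m) _
    Avoiding t x y = Adj H x y × x ≢ t × y ≢ t

    Reach : Fin m → Rel (Fin m) _
    Reach t = Star (Avoiding t)

    Reach-sym : ∀ {t x y} → Reach t x y → Reach t y x
    Reach-sym = reverse (λ (xy , x≢t , y≢t) → adj-swap xy , y≢t , x≢t)

    Reach-avoids : ∀ {t x y} → Reach t x y → x ≢ t → y ≢ t
    Reach-avoids ε                      x≢t = x≢t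
    Reach-avoids ((_ , _ , y≢t) ◅ walk) x≢t = Reach-avoids walk y≢t

    -- The neighbour `s` follows the last visit of the walk to `t`, so the induction looks at the
    -- end of the walk first.
    exit : ∀ {t x} → Star (Adj H) t x → x ≢ t → ∃[ s ] (Adj H t s × Reach t s x)
    exit {t} {x} walk x≢t with go walk
      where
      go : ∀ {w} → Star (Adj H) w x → Reach t w x ⊎ (∃[ s ] (Adj H t s × Reach t s x))
      go ε = inj₁ ε
      go {w} (_◅_ {j = y} wy walk) with go walk
      ... | inj₂ found = inj₂ found
      ... | inj₁ r with w Finₚ.≟ t | y Finₚ.≟ t
      ... | yes refl | _        = inj₂ (y , wy , r)
      ... | no  _    | yes refl = ⊥-elim (Reach-avoids (Reach-sym r) x≢t refl)
      ... | no  w≢t  | no y≢t   = inj₁ ((wy , w≢t , y≢t) ◅ r)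
    ... | inj₂ found = found
    ... | inj₁ r     = ⊥-elim (Reach-avoids (Reach-sym r) x≢t refl)

    -- Joining the two walks at x gives a walk from s to t that does not use the
    -- edge between them.
    edge-separates : ¬ Cycle H → ∀ {s t x} → Adj H t s → Reach t s x → ¬ Reach s t x
    edge-separates acyclic {s} {t} {x} ts sx tx = finish (simplify walk)
      where
      -- Only the step from `s` to `t` is forbidden. It is what a simple path of length one would
      -- consist of; a longer one is closed to a cycle by the edge from `t` to `s`.
      E : Rel (Fin m) _
      E x y = Adj H x y × ¬ (x ≡ s × y ≡ t)

      walk : Star E s t
      walk = gmap id (λ (xy , _ , y≢t) → xy , y≢t ∘ proj₂) sx
          ◅◅ gmap id (λ (xy , x≢s , _) → xy , x≢s ∘ proj₁) (Reach-sym tx)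

      finish : ¬ SimplePath E s t
      finish record { len = 0 ; start = refl ; end = refl } = adj-distinct ts refl
      finish record { len = 1 ; start = start ; end = end ; step = step } =
        proj₂ (step Fin.zero) (start , end)
      finish record { len = suc (suc k) ; vertex = vertex ; start = start ; end = end
                    ; distinct = distinct ; step = step } =
        acyclic record
          { k = k ; vertex = vertex ; distinct = distinct ; step = proj₁ ∘ step
          ; close = subst (λ x → Adj H x _) (sym end) (subst (Adj H t) (sym start) ts) }

  -- Separating a graph along a tree decomposition

  -- The decision procedures are part of the data because `separable-complete` reads a labelling off
  -- them.
  record Separated {n} (G : Graph n) (a : ℕ) : Set₁ where
    field
      {A B}    : Pred (Fin n) _
      A?       : Decidable A
      B?       : Decidable B
      A-large  : a ≤ count A?
      B-large  : a ≤ count B?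
      disjoint : ∀ {v} → A v → ¬ B v
      no-edge  : ∀ {u v} → A u → B v → ¬ Adj G u v

  module _ {n} {G : Graph n} (D : TreeDecomposition G) where
    open TreeDecomposition D hiding (width)

    private
      node : Fin n → Fin size
      node v = proj₁ (coversVertex v)

    -- The walk through bags containing `v` cannot pass `t`, whose bag omits `v`. Hence any bag
    -- containing `v` shows in which branch at `t` it lies, and the choice made by `node` is
    -- harmless.
    reach-bags : ∀ {t x y} v → v ∉ bag t → v ∈ bag x → v ∈ bag y → Reach tree t x y
    reach-bags {t} v v∉t v∈x v∈y = gmap id avoid (connected v _ _ v∈x v∈y)
      where
      avoid : ∀ {a b} → Adj tree a b × v ∈ bag a × v ∈ bag b → Avoiding tree t a b
      avoid (ab , v∈a , v∈b) = ab , (λ { refl → v∉t v∈a }) , (λ { refl → v∉t v∈b })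

    reach-node : ∀ {t x} v → v ∉ bag t → v ∈ bag x → Reach tree t (node v) x
    reach-node v v∉t = reach-bags v v∉t (proj₂ (coversVertex v))

    reach-edge : ∀ {t u v} → u ∉ bag t → v ∉ bag t → Adj G u v → Reach tree t (node u) (node v)
    reach-edge {t} {u} {v} u∉t v∉t uv with coversEdge u v uv
    ... | x , u∈x , v∈x = reach-node u u∉t u∈x ◅◅ Reach-sym tree (reach-node v v∉t v∈x)

    Beyond : Fin size → Fin size → Pred (Fin n) _
    Beyond t s v = v ∉ bag t × Reach tree t s (node v)

    -- A bag containing both ends of an edge would lie on both sides of the tree edge between `s`
    -- and `t`.
    beyond-separated : ∀ {s t u v} → Adj tree t s → Beyond t s u → Beyond s t v → ¬ Adj G u v
    beyond-separated {u = u} {v} ts (u∉t , su) (v∉s , tv) uv with coversEdge u v uv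
    ... | x , u∈x , v∈x = edge-separates tree (proj₂ isTree) ts
      (su ◅◅ reach-node u u∉t u∈x) (tv ◅◅ reach-node v v∉s v∈x)

    module _ (reach? : ∀ t x y → Dec (Reach tree t x y))
             (a : ℕ) (a>0 : 0 < a) (small : ∀ t → ∣ bag t ∣ + (a + a + a) ≤ n)
             (inseparable : ¬ Separated G a) where

      private
        adj? : ∀ x y → Dec (Adj tree x y)
        adj? x y = T? (adj tree x y)

        beyond? : ∀ t s → Decidable (Beyond t s)
        beyond? t s v = ¬? (v ∈? bag t) ×-dec reach? t s (node v)

        -- Grouping the branches at `t` by the index of their first node reduces the choice of a
        -- grouping to that of one number `j`.
        Prefix : Fin size → ℕ → Pred (Fin n) _
        Prefix t j v = v ∉ bag t × ∃[ s ] (toℕ s < j × Adj tree t s × Reach tree t s (node v))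

        prefix? : ∀ t j → Decidable (Prefix t j)
        prefix? t j v = ¬? (v ∈? bag t) ×-dec
          Finₚ.any? (λ s → (toℕ s ℕₚ.<? j) ×-dec (adj? t s ×-dec reach? t s (node v)))

        Rest : Fin size → ℕ → Pred (Fin n) _
        Rest t j v = v ∉ bag t × ¬ Prefix t j v

        rest? : ∀ t j → Decidable (Rest t j)
        rest? t j v = ¬? (v ∈? bag t) ×-dec ¬? (prefix? t j v)

        -- An edge with both ends outside the bag of `t` stays within one branch, so no edge joins
        -- the two groups.
        rest-small : ∀ t j → a ≤ count (prefix? t j) → count (rest? t j) < a
        rest-small t j a≤P with a ℕₚ.≤? count (rest? t j)
        ... | no a≰R = ℕₚ.≰⇒> a≰R
        ... | yes a≤R = ⊥-elim (inseparable record
          { A? = prefix? t j ; B? = rest? t j ; A-large = a≤P ; B-large = a≤R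
          ; disjoint = λ Pv (_ , ¬Pv) → ¬Pv Pv
          ; no-edge  = λ { (u∉t , s , s<j , ts , su) (v∉t , ¬Pv) uv →
              ¬Pv (v∉t , s , s<j , ts , su ◅◅ reach-edge u∉t v∉t uv) }
          })

        all-in-prefix : ∀ t {v} → v ∉ bag t → Prefix t size v
        all-in-prefix t {v} v∉t
          with exit tree (proj₂ (proj₁ isTree) t (node v))
                         (λ { refl → v∉t (proj₂ (coversVertex v)) })
        ... | s , ts , sv = v∉t , s , Finₚ.toℕ<n s , ts , sv

        outside-large : ∀ t → a + a + a ≤ count (λ v → ¬? (v ∈? bag t))
        outside-large t = ℕₚ.+-cancelˡ-≤ ∣ bag t ∣ _ _ (begin
          ∣ bag t ∣ + (a + a + a)               ≤⟨ small t ⟩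
          n                                     ≡⟨ count-U U?-n (λ _ → _) ⟨
          count U?-n                            ≤⟨ count-∪ U?-n (_∈? bag t) outside? in-or-out ⟩
          count (_∈? bag t) + count outside?    ≡⟨ cong (_+ count outside?) (count-∈ (bag t)) ⟩
          ∣ bag t ∣ + count outside?            ∎)
          where
          open ℕₚ.≤-Reasoning
          outside? : Decidable (_∉ bag t)
          outside? v = ¬? (v ∈? bag t)
          U?-n : Decidable (U {A = Fin n})
          U?-n = U?
          in-or-out : ∀ {v} → U v → v ∈ bag t ⊎ v ∉ bag t
          in-or-out {v} _ with v ∈? bag t
          ... | yes v∈t = inj₁ v∈t
          ... | no  v∉t = inj₂ v∉t

        abstract
          -- Take the first j at which the prefix reaches size a.  Fewer than a vertices
          -- then remain, so the last neighbour alone accounts for at least a of them.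
          heavy-side : ∀ t → ∃[ s ] (Adj tree t s × a ≤ count (beyond? t s))
          heavy-side t
            with crossing (λ j → count (prefix? t j)) a size
                   (subst (_< a) (sym (count-∅ (prefix? t 0) λ { (_ , _ , () , _) })) a>0)
                   (ℕₚ.≤-trans (ℕₚ.≤-trans (ℕₚ.m≤n+m a (a + a)) (outside-large t))
                               (count-⊆ (λ v → ¬? (v ∈? bag t)) (prefix? t size) (all-in-prefix t)))
          ... | j , j<size , P<a , a≤P⁺ = s , ts , a≤W
            where
            s : Fin size
            s = fromℕ< j<size

            last : ∀ {x : Fin size} → toℕ x < suc j → toℕ x < j ⊎ x ≡ s
            last {x} x<1+j with ℕₚ.m≤n⇒m<n∨m≡n (ℕ.s≤s⁻¹ x<1+j)
            ... | inj₁ x<j = inj₁ x<j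
            ... | inj₂ x≡j = inj₂ (Finₚ.toℕ-injective (trans x≡j (sym (Finₚ.toℕ-fromℕ< j<size))))

            -- Were the node with index `j` no neighbour of `t`, passing it would add nothing to the
            -- prefix, which however crosses `a` there.
            ts : Adj tree t s
            ts with adj? t s
            ... | yes ts = ts
            ... | no ¬ts = ⊥-elim (ℕₚ.<⇒≱ P<a
              (ℕₚ.≤-trans a≤P⁺ (count-⊆ (prefix? t (suc j)) (prefix? t j) shrink)))
              where
              shrink : ∀ {v} → Prefix t (suc j) v → Prefix t j v
              shrink (v∉t , x , x<1+j , tx , xv) with last x<1+j
              ... | inj₁ x<j  = v∉t , x , x<j , tx , xv
              ... | inj₂ refl = ⊥-elim (¬ts tx)

            split : ∀ {v} → v ∉ bag t → Beyond t s v ⊎ (Prefix t j v ⊎ Rest t (suc j) v)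
            split {v} v∉t with prefix? t (suc j) v
            ... | no ¬Pv = inj₂ (inj₂ (v∉t , ¬Pv))
            ... | yes (_ , x , x<1+j , tx , xv) with last x<1+j
            ... | inj₁ x<j  = inj₂ (inj₁ (v∉t , x , x<j , tx , xv))
            ... | inj₂ refl = inj₁ (v∉t , xv)

            union? : Decidable (λ v → Prefix t j v ⊎ Rest t (suc j) v)
            union? v = prefix? t j v ⊎-dec rest? t (suc j) v

            a≤W : a ≤ count (beyond? t s)
            a≤W = ℕₚ.+-cancelʳ-≤ (a + a) _ _ (begin
              a + (a + a)                              ≡⟨ ℕₚ.+-assoc a a a ⟨
              a + a + a                                ≤⟨ outside-large t ⟩
              count (λ v → ¬? (v ∈? bag t))
                ≤⟨ count-∪ (λ v → ¬? (v ∈? bag t)) (beyond? t s) union? split ⟩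
              count (beyond? t s) + count union?
                ≤⟨ ℕₚ.+-monoʳ-≤ (count (beyond? t s))
                     (count-∪ union? (prefix? t j) (rest? t (suc j)) id) ⟩
              count (beyond? t s) + (count (prefix? t j) + count (rest? t (suc j)))
                ≤⟨ ℕₚ.+-monoʳ-≤ (count (beyond? t s))
                     (ℕₚ.+-mono-≤ (ℕₚ.<⇒≤ P<a) (ℕₚ.<⇒≤ (rest-small t (suc j) a≤P⁺))) ⟩
              count (beyond? t s) + (a + a)            ∎)
              where open ℕₚ.≤-Reasoning

        -- Follow the heavy sides.  Turning back over an edge would separate G, and
        -- otherwise the part of the tree ahead shrinks at every step.
        descend : ∀ t s → Adj tree t s → a ≤ count (beyond? t s) →
                  ¬ Acc _<_ (count (reach? t s))
        descend t s ts heavy (acc rec) with heavy-side s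
        -- Turning back is tested by reachability, not by `u ≡ t`. A walk from `u` to `t` avoiding
        -- `s` puts everything beyond `u` on the side of `t`; the absence of such a walk is what
        -- lets the part ahead shrink.
        ... | u , su , heavy′ with reach? s u t
        ... | yes ut = inseparable record
          { A? = beyond? t s ; B? = beyond? s t ; A-large = heavy
          ; B-large  = ℕₚ.≤-trans heavy′ (count-⊆ (beyond? s u) (beyond? s t)
                         λ (v∉s , uv) → v∉s , Reach-sym tree ut ◅◅ uv)
          ; disjoint = λ (_ , sv) (_ , tv) → edge-separates tree (proj₂ isTree) ts sv tv
          ; no-edge  = beyond-separated ts
          }
        -- The node `s` lies ahead of the old position but not of the new one, so the inclusion is
        -- strict.
        ... | no u↛t = descend s u su heavy′ (rec (count-⊂ (reach? s u) (reach? t s)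
          ahead s (λ us → Reach-avoids tree us (adj-distinct tree (adj-swap tree su)) refl) ε))
          where
          s≢t : s ≢ t
          s≢t = adj-distinct tree (adj-swap tree ts)
          -- The first argument remembers the walk from `u`: a visit to `t` would extend it to a
          -- walk excluded by `u↛t`.
          go : ∀ {x y} → Reach tree s u x → Reach tree s x y → Reach tree t x y
          go ux ε = ε
          go ux (xy@(xy′ , _) ◅ walk) =
            (xy′ , (λ { refl → u↛t ux }) , (λ { refl → u↛t (ux ◅◅ xy ◅ ε) }))
            ◅ go (ux ◅◅ xy ◅ ε) walk
          ahead : ∀ {x} → Reach tree s u x → Reach tree t s x
          ahead ux = (su , s≢t , λ { refl → u↛t ε }) ◅ go ε ux

      not-all-small : ⊥
      not-all-small with heavy-side (proj₁ (proj₁ isTree))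
      ... | s , ts , heavy = descend _ s ts heavy (<-wellFounded _)

    -- Excluded middle holds under double negation at each triple, and double negation commutes with
    -- finite quantifiers.
    ¬¬-reach? : ¬ ¬ (∀ t x y → Dec (Reach tree t x y))
    ¬¬-reach? = all λ t → all λ x → all λ y → ¬¬-excluded-middle
      where
      all : ∀ {n} {P : Fin n → Set} → (∀ i → ¬ ¬ P i) → ¬ ¬ (∀ i → P i)
      all = Finₚ.sequence (RawMonad.rawApplicative ¬¬-Monad)

    bag≤1+width : ∀ t → ∣ bag t ∣ ≤ suc (TreeDecomposition.width D)
    bag≤1+width t = ℕₚ.≤-trans (≤-max (λ t → ∣ bag t ∣) t) (≤1+pred _)
      where
      ≤1+pred : ∀ m → m ≤ suc (ℕ.pred m)
      ≤1+pred zero    = z≤n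
      ≤1+pred (suc m) = ℕₚ.≤-refl

      ≤-max : ∀ {m} (f : Fin m → ℕ) i → f i ≤ Vector.foldr ℕ._⊔_ 0 f
      ≤-max f Fin.zero    = ℕₚ.m≤m⊔n _ _
      ≤-max f (Fin.suc i) = ℕₚ.≤-trans (≤-max (f ∘ Fin.suc) i) (ℕₚ.m≤n⊔m _ _)

    -- The negated bound unfolds to `suc width` plus `3a` being at most `n`, which is the smallness
    -- of all bags that `not-all-small` refutes. The size is written `suc b` to be positive.
    inseparable⇒wide : ∀ b → ¬ Separated G (suc b) →
                       n ≤ TreeDecomposition.width D + (suc b + suc b + suc b)
    inseparable⇒wide b inseparable = ℕₚ.≮⇒≥ λ narrow → ¬¬-reach? λ reach? →
      not-all-small reach? (suc b) (s≤s z≤n)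
        (λ t → ℕₚ.≤-trans (ℕₚ.+-monoˡ-≤ _ (bag≤1+width t)) narrow) inseparable

open TreeSeparations

-- Separations as labellings of the vertices

module Labellings where
  open import Data.Nat.Base using (_≤_; _+_; _*_)
  open ≡ using (refl)

  private variable
    n : ℕ

  data Side : Set where
    left right neither : Side

  opposite : Side → Side → Bool
  opposite left  right = true
  opposite right left  = true
  opposite _     _     = false

  lefts rights : Vec Side n → ℕ
  lefts []            = 0
  lefts (left    ∷ L) = suc (lefts L)
  lefts (right   ∷ L) = lefts L
  lefts (neither ∷ L) = lefts L
  rights []            = 0
  rights (left    ∷ L) = rights L
  rights (right   ∷ L) = suc (rights L)
  rights (neither ∷ L) = rights L

  opposites : Side → Vec Side n → ℕ
  opposites left    L = rights L
  opposites right   L = lefts L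
  opposites neither L = 0

  opposites-∷ : ∀ s t (L : Vec Side n) →
                opposites s (t ∷ L) ≡ (if opposite s t then 1 else 0) + opposites s L
  opposites-∷ left    left    L = refl
  opposites-∷ left    right   L = refl
  opposites-∷ left    neither L = refl
  opposites-∷ right   left    L = refl
  opposites-∷ right   right   L = refl
  opposites-∷ right   neither L = refl
  opposites-∷ neither left    L = refl
  opposites-∷ neither right   L = refl
  opposites-∷ neither neither L = refl

  -- Counts the crossing pairs row by row, so that the exponent of `q` splits along the recursion of
  -- `Coins`.
  lefts*rights-∷ : ∀ s (L : Vec Side n) →
                   lefts (s ∷ L) * rights (s ∷ L) ≡ opposites s L + lefts L * rights L
  lefts*rights-∷ left    L = refl
  lefts*rights-∷ right   L = ℕₚ.*-suc (lefts L) (rights L)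
  lefts*rights-∷ neither L = refl

  -- r holds the coins of the pairs {i , j} for a fixed vertex i on side s.
  rowEmpty : Side → Vec Side n → (Fin n → Bool) → Bool
  rowEmpty s []      r = true
  rowEmpty s (t ∷ L) r = not (opposite s t ∧ r Fin.zero) ∧ rowEmpty s L (r ∘ Fin.suc)

  -- The first conjunct reads only the first row of coins and the second only the others; this gives
  -- independence.
  noCrossing : Vec Side n → (Fin n → Fin n → Bool) → Bool
  noCrossing []      adj = true
  noCrossing (s ∷ L) adj =
    rowEmpty s L (adj Fin.zero ∘ Fin.suc) ∧ noCrossing L (λ i j → adj (Fin.suc i) (Fin.suc j))

  large : ℕ → Vec Side n → Bool
  large a L = (a ≤ᵇ lefts L) ∧ (a ≤ᵇ rights L)

  large-sound : ∀ a (L : Vec Side n) → T (large a L) → a ≤ lefts L × a ≤ rights L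
  large-sound a L t = ℕₚ.≤ᵇ⇒≤ a _ (proj₁ both) , ℕₚ.≤ᵇ⇒≤ a _ (proj₂ both)
    where both = Equivalence.to T-∧ t

  anyLabelling : ∀ n → (Vec Side n → Bool) → Bool
  anyLabelling zero    E = E []
  anyLabelling (suc n) E =
    anyLabelling n (E ∘ (left ∷_)) ∨
    anyLabelling n (E ∘ (right ∷_)) ∨
    anyLabelling n (E ∘ (neither ∷_))

  -- The bad event. `Separated` ranges over predicates, while this is a finite search and thus a
  -- Boolean.
  separable : ∀ a n → (Fin n → Fin n → Bool) → Bool
  separable a n adj = anyLabelling n (λ L → large a L ∧ noCrossing L adj)

  T-∨ˡ : ∀ {x y} → T x → T (x ∨ y)
  T-∨ˡ {true} _ = tt

  T-∨ʳ : ∀ x {y} → T y → T (x ∨ y)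
  T-∨ʳ true  _ = tt
  T-∨ʳ false t = t

  T-∧⁺ : ∀ {x y} → T x → T y → T (x ∧ y)
  T-∧⁺ t u = Equivalence.from T-∧ (t , u)

  anyLabelling-complete : (E : Vec Side n → Bool) (L : Vec Side n) → T (E L) → T (anyLabelling n E)
  anyLabelling-complete E []            t = t
  anyLabelling-complete E (left    ∷ L) t = T-∨ˡ (anyLabelling-complete (E ∘ (left ∷_)) L t)
  anyLabelling-complete {suc n} E (right ∷ L) t =
    T-∨ʳ (anyLabelling n (E ∘ (left ∷_))) (T-∨ˡ (anyLabelling-complete (E ∘ (right ∷_)) L t))
  anyLabelling-complete {suc n} E (neither ∷ L) t =
    T-∨ʳ (anyLabelling n (E ∘ (left ∷_)))
      (T-∨ʳ (anyLabelling n (E ∘ (right ∷_))) (anyLabelling-complete (E ∘ (neither ∷_)) L t))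

  rowEmpty-complete : ∀ s (L : Vec Side n) r →
                      (∀ j → T (opposite s (lookup L j)) → ¬ T (r j)) → T (rowEmpty s L r)
  rowEmpty-complete s []      r empty = tt
  rowEmpty-complete s (t ∷ L) r empty =
    T-∧⁺ (nand _ _ (empty Fin.zero)) (rowEmpty-complete s L (r ∘ Fin.suc) (empty ∘ Fin.suc))
    where
    nand : ∀ x y → (T x → ¬ T y) → T (not (x ∧ y))
    nand false y     _ = tt
    nand true  false _ = tt
    nand true  true  f = f tt tt

  noCrossing-complete : ∀ (L : Vec Side n) adj →
                        (∀ i j → T (opposite (lookup L i) (lookup L j)) → ¬ T (adj i j)) →
                        T (noCrossing L adj)
  noCrossing-complete []      adj empty = tt
  noCrossing-complete (s ∷ L) adj empty =
    T-∧⁺ (rowEmpty-complete s L _ (empty Fin.zero ∘ Fin.suc))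
         (noCrossing-complete L _ (λ i j → empty (Fin.suc i) (Fin.suc j)))

  -- Label `A` left, `B` right and the rest neither. Testing `A` first is harmless since the sets
  -- are disjoint.
  separable-complete : ∀ {a} (G : Graph n) → Separated G a → T (separable a n (adj G))
  separable-complete {n} {a} G sep =
    anyLabelling-complete (λ L → large a L ∧ noCrossing L (adj G)) L
      (T-∧⁺ (T-∧⁺ (ℕₚ.≤⇒≤ᵇ (ℕₚ.≤-trans A-large (≤lefts A? side A⇒left)))
                  (ℕₚ.≤⇒≤ᵇ (ℕₚ.≤-trans B-large (≤rights B? side B⇒right))))
            (noCrossing-complete L (adj G) uncrossed))
    where
    open Separated sep

    side : Fin n → Side
    side v = if does (A? v) then left else if does (B? v) then right else neither

    L : Vec Side n
    L = tabulate side

    A⇒left : ∀ v → A v → side v ≡ left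
    A⇒left v Av with A? v
    ... | yes _  = refl
    ... | no ¬Av = ⊥-elim (¬Av Av)

    B⇒right : ∀ v → B v → side v ≡ right
    B⇒right v Bv with A? v | B? v
    ... | yes Av | _      = ⊥-elim (disjoint Av Bv)
    ... | no _   | yes _  = refl
    ... | no _   | no ¬Bv = ⊥-elim (¬Bv Bv)

    ≤lefts : ∀ {n} {P : Pred (Fin n) _} (P? : Decidable P) (f : Fin n → Side) →
             (∀ v → P v → f v ≡ left) → count P? ≤ lefts (tabulate f)
    ≤lefts {zero}  P? f P⇒left = z≤n
    ≤lefts {suc n} P? f P⇒left
      with P? Fin.zero | f Fin.zero | P⇒left Fin.zero
         | ≤lefts (P? ∘ Fin.suc) (f ∘ Fin.suc) (P⇒left ∘ Fin.suc)
    ... | yes p | s       | eq | ih rewrite eq p = s≤s ih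
    ... | no _  | left    | _  | ih = ℕₚ.m≤n⇒m≤1+n ih
    ... | no _  | right   | _  | ih = ih
    ... | no _  | neither | _  | ih = ih

    ≤rights : ∀ {n} {P : Pred (Fin n) _} (P? : Decidable P) (f : Fin n → Side) →
              (∀ v → P v → f v ≡ right) → count P? ≤ rights (tabulate f)
    ≤rights {zero}  P? f P⇒right = z≤n
    ≤rights {suc n} P? f P⇒right
      with P? Fin.zero | f Fin.zero | P⇒right Fin.zero
         | ≤rights (P? ∘ Fin.suc) (f ∘ Fin.suc) (P⇒right ∘ Fin.suc)
    ... | yes p | s       | eq | ih rewrite eq p = s≤s ih
    ... | no _  | left    | _  | ih = ih
    ... | no _  | right   | _  | ih = ℕₚ.m≤n⇒m≤1+n ih
    ... | no _  | neither | _  | ih = ih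

    opposite-edge : ∀ i j → T (opposite (side i) (side j)) → ¬ Adj G i j
    opposite-edge i j opp ij with A? i | B? i | A? j | B? j
    ... | yes Ai | _      | no _   | yes Bj = no-edge Ai Bj ij
    ... | no _   | yes Bi | yes Aj | _      = no-edge Aj Bi (adj-swap G ij)
    ... | no _   | yes _  | no _   | yes _  = opp
    ... | no _   | yes _  | no _   | no _   = opp
    ... | no _   | no _   | _      | _      = opp

    uncrossed : ∀ i j → T (opposite (lookup L i) (lookup L j)) → ¬ Adj G i j
    uncrossed i j opp rewrite lookup∘tabulate side i | lookup∘tabulate side j =
      opposite-edge i j opp

open Labellings

-- Ordered field arithmetic without decidable comparison

module OrderedField {c ℓ₁ ℓ₂} (ℝ : RealNumbers c ℓ₁ ℓ₂) where
  open RealNumbers ℝ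
  open CommutativeRing commutativeRing public
    using (semiring; commutativeSemiring; ring; +-group)
  open IsStrictPartialOrder isStrictPartialOrder public
    using (<-resp-≈; <-respˡ-≈; <-respʳ-≈)
    renaming (irrefl to <-irrefl; trans to <-trans; asym to <-asym)
  open SemiringExp semiring public using (_^_; ^-homo-*; ^-assocʳ)

  private
    module ≈-Reasoning = SetoidReasoning setoid
    module Solver = NaturalSolver commutativeSemiring
    open Solver using (solve; _:+_; _:*_; _:=_; con)

  private variable
    x y z w : Carrier

  <-cotrans : x < y → ∀ z → x < z ⊎ z < y
  <-cotrans x<y z with #-cotrans (<⇒# x<y) z
  ... | inj₁ x#z = [ inj₁ , (λ z<x → inj₂ (<-trans z<x x<y)) ]′ (#⇒<⊎> x#z)
  ... | inj₂ z#y = [ inj₂ , (λ y<z → inj₁ (<-trans x<y y<z)) ]′ (#⇒<⊎> z#y)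

  -- Tightness of apartness turns the failure of both strict comparisons into equality. As `_≤_` is
  -- a negation, its proofs may argue by these three cases.
  ¬¬-compare : ∀ x y → ¬ ¬ (x < y ⊎ x ≈ y ⊎ y < x)
  ¬¬-compare x y k = k (inj₂ (inj₁ (proj₁ (tight x y)
    ([ k ∘ inj₁ , k ∘ inj₂ ∘ inj₂ ]′ ∘ #⇒<⊎>))))

  <⇒≤ : x < y → x ≤ y
  <⇒≤ = <-asym

  ≤-reflexive : x ≈ y → x ≤ y
  ≤-reflexive x≈y y<x = <-irrefl (sym x≈y) y<x

  ≤-refl : x ≤ x
  ≤-refl = ≤-reflexive refl

  <-≤-trans : x < y → y ≤ z → x < z
  <-≤-trans x<y y≤z = [ (λ x<z → x<z) , ⊥-elim ∘ y≤z ]′ (<-cotrans x<y _)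

  ≤-<-trans : x ≤ y → y < z → x < z
  ≤-<-trans x≤y y<z = [ ⊥-elim ∘ x≤y , (λ x<z → x<z) ]′ (<-cotrans y<z _)

  ≤-trans : x ≤ y → y ≤ z → x ≤ z
  ≤-trans x≤y y≤z z<x = y≤z (<-≤-trans z<x x≤y)

  ≤-isPreorder : IsPreorder _≈_ _≤_
  ≤-isPreorder = record
    { isEquivalence = isEquivalence ; reflexive = ≤-reflexive ; trans = ≤-trans }

  module ≤-Reasoning = Triple ≤-isPreorder <-asym <-trans <-resp-≈ <⇒≤ <-≤-trans ≤-<-trans
    hiding (step-≈; step-≈˘)

  +-monoʳ-< : ∀ z → x < y → z + x < z + y
  +-monoʳ-< z x<y = <-respˡ-≈ (+-comm _ z) (<-respʳ-≈ (+-comm _ z) (+-monoˡ-< z x<y))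

  x+z-z≈x : ∀ x z → x + z - z ≈ x
  x+z-z≈x x z = GroupProperties.//-rightDividesʳ +-group z x

  x-z+z≈x : ∀ x z → x - z + z ≈ x
  x-z+z≈x x z = GroupProperties.//-rightDividesˡ +-group z x

  +-cancelʳ-< : ∀ z → x + z < y + z → x < y
  +-cancelʳ-< z x+z<y+z =
    <-respˡ-≈ (x+z-z≈x _ z) (<-respʳ-≈ (x+z-z≈x _ z) (+-monoˡ-< (- z) x+z<y+z))

  +-monoˡ-≤ : ∀ z → x ≤ y → x + z ≤ y + z
  +-monoˡ-≤ z x≤y = x≤y ∘ +-cancelʳ-< z

  +-monoʳ-≤ : ∀ z → x ≤ y → z + x ≤ z + y
  +-monoʳ-≤ z x≤y z+y<z+x =
    +-monoˡ-≤ z x≤y (<-respˡ-≈ (+-comm z _) (<-respʳ-≈ (+-comm z _) z+y<z+x))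

  +-mono-≤ : x ≤ y → z ≤ w → x + z ≤ y + w
  +-mono-≤ x≤y z≤w = ≤-trans (+-monoˡ-≤ _ x≤y) (+-monoʳ-≤ _ z≤w)

  x<y⇒0<y-x : x < y → 0# < y - x
  x<y⇒0<y-x {x} x<y = <-respˡ-≈ (-‿inverseʳ x) (+-monoˡ-< (- x) x<y)

  0<y-x⇒x<y : 0# < y - x → x < y
  0<y-x⇒x<y {y} {x} 0<y-x =
    <-respˡ-≈ (+-identityˡ x) (<-respʳ-≈ (x-z+z≈x y x) (+-monoˡ-< x 0<y-x))

  x≤x+y : ∀ x → 0# ≤ y → x ≤ x + y
  x≤x+y x 0≤y = ≤-trans (≤-reflexive (sym (+-identityʳ x))) (+-monoʳ-≤ x 0≤y)

  *-monoˡ-< : 0# < z → x < y → x * z < y * z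
  *-monoˡ-< {z} {x} {y} 0<z x<y = <-respˡ-≈ (+-identityˡ _) (<-respʳ-≈ eq
    (+-monoˡ-< (x * z) (*-positive (x<y⇒0<y-x x<y) 0<z)))
    where
    eq : (y - x) * z + x * z ≈ y * z
    eq = trans (sym (distribʳ z (y - x) x)) (*-congʳ (x-z+z≈x y x))

  *-monoˡ-≤ : 0# ≤ z → x ≤ y → x * z ≤ y * z
  *-monoˡ-≤ {z} {x} {y} 0≤z x≤y yz<xz = ¬¬-compare x y λ
    { (inj₂ (inj₂ y<x)) → x≤y y<x
    ; (inj₂ (inj₁ x≈y)) → <-irrefl (*-congʳ (sym x≈y)) yz<xz
    ; (inj₁ x<y) → ¬¬-compare 0# z λ
      { (inj₁ 0<z) → <-asym (*-monoˡ-< 0<z x<y) yz<xz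
      ; (inj₂ (inj₂ z<0)) → 0≤z z<0
      ; (inj₂ (inj₁ 0≈z)) → <-irrefl (trans (vanish y 0≈z) (sym (vanish x 0≈z))) yz<xz
      }
    }
    where
    vanish : ∀ w → 0# ≈ z → w * z ≈ 0#
    vanish w 0≈z = trans (*-congˡ (sym 0≈z)) (zeroʳ w)

  *-monoʳ-≤ : 0# ≤ z → x ≤ y → z * x ≤ z * y
  *-monoʳ-≤ {z} {x} {y} 0≤z x≤y = ≤-trans (≤-reflexive (*-comm z x))
    (≤-trans (*-monoˡ-≤ 0≤z x≤y) (≤-reflexive (*-comm y z)))

  *-nonneg : 0# ≤ x → 0# ≤ y → 0# ≤ x * y
  *-nonneg {x} {y} 0≤x 0≤y = ≤-trans (≤-reflexive (sym (zeroˡ y))) (*-monoˡ-≤ 0≤y 0≤x)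

  square-cancel-≤ : 0# ≤ y → x * x ≤ y * y → x ≤ y
  square-cancel-≤ 0≤y x²≤y² y<x =
    x²≤y² (≤-<-trans (*-monoʳ-≤ 0≤y (<⇒≤ y<x)) (*-monoˡ-< (≤-<-trans 0≤y y<x) y<x))

  -- If 1 were negative, then -1 and its square would be positive, although they sum to 0.
  0<1 : 0# < 1#
  0<1 with #⇒<⊎> (1#0 heytingCommutativeRing)
  ... | inj₂ 0<1 = 0<1
  ... | inj₁ 1<0 = ⊥-elim (<-irrefl (sym cancel) (<-trans (*-positive 0<-1 0<-1)
          (<-respˡ-≈ (+-identityʳ _) (+-monoʳ-< (- 1# * - 1#) 0<-1))))
    where
    0<-1 : 0# < - 1#
    0<-1 = <-respʳ-≈ (+-identityˡ (- 1#)) (x<y⇒0<y-x 1<0)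
    cancel : - 1# * - 1# + - 1# ≈ 0#
    cancel = begin
      - 1# * - 1# + - 1#        ≈⟨ +-congˡ (*-identityʳ (- 1#)) ⟨
      - 1# * - 1# + - 1# * 1#   ≈⟨ distribˡ (- 1#) (- 1#) 1# ⟨
      - 1# * (- 1# + 1#)        ≈⟨ *-congˡ (-‿inverseˡ 1#) ⟩
      - 1# * 0#                 ≈⟨ zeroʳ (- 1#) ⟩
      0#                        ∎
      where open ≈-Reasoning

  -- Natural numbers

  fromNat-+ : ∀ m n → fromNat (m ℕ.+ n) ≈ fromNat m + fromNat n
  fromNat-+ = Mult.×-homo-+ semiring 1#

  fromNat-* : ∀ m n → fromNat (m ℕ.* n) ≈ fromNat m * fromNat n
  fromNat-* = Mult.×1-homo-* semiring

  fromNat-^ : ∀ m n → fromNat (m ℕ.^ n) ≈ fromNat m ^ n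
  fromNat-^ m zero    = +-identityʳ 1#
  fromNat-^ m (suc n) = trans (fromNat-* m (m ℕ.^ n)) (*-congˡ (fromNat-^ m n))

  0≤fromNat : ∀ n → 0# ≤ fromNat n
  0≤fromNat zero    = ≤-refl
  0≤fromNat (suc n) = ≤-trans (0≤fromNat n) (≤-trans (≤-reflexive (sym (+-identityˡ _)))
    (+-monoˡ-≤ (fromNat n) (<⇒≤ 0<1)))

  fromNat-mono-≤ : ∀ {m n} → m ℕ.≤ n → fromNat m ≤ fromNat n
  fromNat-mono-≤ {n = n} ℕ.z≤n   = 0≤fromNat n
  fromNat-mono-≤ (ℕ.s≤s m≤n) = +-monoʳ-≤ 1# (fromNat-mono-≤ m≤n)

  fromNat-mono-< : ∀ {m n} → m ℕ.< n → fromNat m < fromNat n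
  fromNat-mono-< {m} m<n = <-≤-trans
    (<-respˡ-≈ (+-identityˡ _) (+-monoˡ-< (fromNat m) 0<1)) (fromNat-mono-≤ m<n)

  fromNat-suc-* : ∀ n x → fromNat (suc n) * x ≈ x + fromNat n * x
  fromNat-suc-* n x = trans (distribʳ x 1# (fromNat n)) (+-congʳ (*-identityˡ x))

  -- Comparing `x` with the ends of `0 < x + n x` gives either `0 < x` or `0 < n x`, and the latter
  -- is the same claim for a smaller `n`.
  fromNat*-positive⁻¹ : ∀ n → 0# < fromNat n * x → 0# < x
  fromNat*-positive⁻¹ {x} zero    0<nx = ⊥-elim (<-irrefl (sym (zeroˡ x)) 0<nx)
  fromNat*-positive⁻¹ {x} (suc n) 0<nx with <-cotrans (<-respʳ-≈ (fromNat-suc-* n x) 0<nx) x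
  ... | inj₁ 0<x = 0<x
  ... | inj₂ x<x+nx = fromNat*-positive⁻¹ n (+-cancelʳ-< x
        (<-respˡ-≈ (sym (+-identityˡ x)) (<-respʳ-≈ (+-comm x _) x<x+nx)))

  fromNat*-cancel-< : ∀ n → fromNat n * x < fromNat n * y → x < y
  fromNat*-cancel-< {x} {y} n nx<ny = 0<y-x⇒x<y (fromNat*-positive⁻¹ n
    (<-respʳ-≈ (sym distrib-minus) (x<y⇒0<y-x nx<ny)))
    where
    distrib-minus : fromNat n * (y - x) ≈ fromNat n * y - fromNat n * x
    distrib-minus = trans (distribˡ (fromNat n) y (- x))
      (+-congˡ (sym (RingProperties.-‿distribʳ-* ring (fromNat n) x)))

  -- Quotients


  ÷-* : ∀ x (0<y : 0# < y) → (x ÷ y [ 0<y ]) * y ≈ x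
  ÷-* {y} x 0<y = trans (*-assoc x _ y) (trans (*-congˡ inverse) (*-identityʳ x))
    where
    invertible = #⇒invertible (#-sym (<⇒# 0<y))
    inverse : proj₁ invertible * y ≈ 1#
    inverse = trans (*-congˡ (sym (x-0≈x heytingCommutativeRing y))) (proj₁ (proj₂ invertible))

  archimedean-* : ∀ b → 0# < y → ∃[ N ] b < fromNat N * y
  archimedean-* b 0<y with archimedean (b ÷ _ [ 0<y ])
  ... | N , b/y<N = N , <-respˡ-≈ (÷-* b 0<y) (*-monoˡ-< 0<y b/y<N)

  -- Comparing N * p with b and 1 + b is decidable up to an overlap, so m can be
  -- found by counting down from any N that is large enough.
  multiple-between : ∀ b {p} → 0# < p → p ≤ 1# →
                     ∃[ m ] (fromNat b ≤ fromNat m * p × fromNat m * p ≤ fromNat (2 ℕ.+ b))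
  multiple-between b {p} 0<p p≤1 with archimedean-* (fromNat b) 0<p
  ... | N , b<Np = go N b<Np
    where
    go : ∀ N → fromNat b < fromNat N * p →
         ∃[ m ] (fromNat b ≤ fromNat m * p × fromNat m * p ≤ fromNat (2 ℕ.+ b))
    go zero    b<0 = ⊥-elim (0≤fromNat b (<-respʳ-≈ (zeroˡ p) b<0))
    go (suc N) b<Np with <-cotrans (fromNat-mono-< (ℕₚ.n<1+n b)) (fromNat N * p)
    ... | inj₁ b<N′p   = go N b<N′p
    -- One more summand `p ≤ 1` turns the bound `1 + b` into `2 + b`.
    ... | inj₂ N′p<1+b = suc N , <⇒≤ b<Np ,
      ≤-trans (≤-reflexive (fromNat-suc-* N p)) (+-mono-≤ p≤1 (<⇒≤ N′p<1+b))

  -- Powers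

  ^-nonneg : 0# ≤ x → ∀ n → 0# ≤ x ^ n
  ^-nonneg 0≤x zero    = <⇒≤ 0<1
  ^-nonneg 0≤x (suc n) = *-nonneg 0≤x (^-nonneg 0≤x n)

  ^≤1 : 0# ≤ x → x ≤ 1# → ∀ n → x ^ n ≤ 1#
  ^≤1 0≤x x≤1 zero    = ≤-refl
  ^≤1 {x} 0≤x x≤1 (suc n) =
    ≤-trans (*-monoˡ-≤ (^-nonneg 0≤x n) x≤1) (≤-trans (≤-reflexive (*-identityˡ _)) (^≤1 0≤x x≤1 n))

  ^-antitone : 0# ≤ x → x ≤ 1# → ∀ {m n} → m ℕ.≤ n → x ^ n ≤ x ^ m
  ^-antitone {x} 0≤x x≤1 {m} {n} m≤n = begin
    x ^ n                    ≡⟨ ≡.cong (x ^_) (ℕₚ.m+[n∸m]≡n m≤n) ⟨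
    x ^ (m ℕ.+ (n ℕ.∸ m))    ≈⟨ ^-homo-* x m (n ℕ.∸ m) ⟩
    x ^ m * x ^ (n ℕ.∸ m)    ≤⟨ *-monoʳ-≤ (^-nonneg 0≤x m) (^≤1 0≤x x≤1 (n ℕ.∸ m)) ⟩
    x ^ m * 1#               ≈⟨ *-identityʳ _ ⟩
    x ^ m                    ∎
    where open ≤-Reasoning

  module _ {p q : Carrier} (0≤p : 0# ≤ p) (0≤q : 0# ≤ q) (p+q≈1 : p + q ≈ 1#) where

    -- Bernoulli's inequality for (1 + p)^m, combined with (1 + p) q ≤ 1.
    bernoulli : ∀ m → (1# + fromNat m * p) * q ^ m ≤ 1#
    bernoulli zero    =
      ≤-reflexive (trans (*-identityʳ _) (trans (+-congˡ (zeroˡ p)) (+-identityʳ 1#)))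
    bernoulli (suc m) = begin
      (1# + (1# + M) * p) * (q * q ^ m)    ≈⟨ *-assoc _ q (q ^ m) ⟨
      (1# + (1# + M) * p) * q * q ^ m      ≤⟨ *-monoˡ-≤ (^-nonneg 0≤q m) factor ⟩
      (1# + M * p) * q ^ m                 ≤⟨ bernoulli m ⟩
      1#                                   ∎
      where
      open ≤-Reasoning
      M = fromNat m
      factor : (1# + (1# + M) * p) * q ≤ 1# + M * p
      factor = begin
        (1# + (1# + M) * p) * q
          -- The added term is exactly the gap between the two sides. Keeping `q` as a variable with
          -- `p + q ≈ 1` leaves an identity without subtraction.
          ≤⟨ x≤x+y _ (≤-trans (≤-reflexive (sym (+-identityˡ 0#)))
               (+-mono-≤ (*-nonneg 0≤p 0≤p) (*-nonneg (0≤fromNat m) (*-nonneg 0≤p 0≤p)))) ⟩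
        (1# + (1# + M) * p) * q + (p * p + M * (p * p))
          ≈⟨ solve 3 (λ p q M →
               (con 1 :+ (con 1 :+ M) :* p) :* q :+ (p :* p :+ M :* (p :* p))
               := (p :* (p :+ q) :+ q) :+ M :* (p :* (p :+ q))) refl p q M ⟩
        (p * (p + q) + q) + M * (p * (p + q))
          ≈⟨ +-cong (+-congʳ p*[p+q]≈p) (*-congˡ p*[p+q]≈p) ⟩
        (p + q) + M * p
          ≈⟨ +-congʳ p+q≈1 ⟩
        1# + M * p ∎
        where
        p*[p+q]≈p : p * (p + q) ≈ p
        p*[p+q]≈p = trans (*-congˡ p+q≈1) (*-identityʳ p)

    q≤1 : q ≤ 1#
    q≤1 = ≤-trans (x≤x+y q 0≤p) (≤-reflexive (trans (+-comm q p) p+q≈1))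

    -- As `n + 1` is at most the `n`-th power of 2, the left side is at most `(6 * q ^ m) ^ n`, and
    -- `bernoulli` bounds the base by 1 because `6 = 1 + 5`. The factor `suc n` makes the
    -- probability tend to 0.
    union-bound-small : ∀ m n A → fromNat 5 ≤ fromNat m * p → m ℕ.* n ℕ.≤ A →
                        fromNat (suc n) * (fromNat (3 ℕ.^ n) * q ^ A) ≤ 1#
    union-bound-small m n A 5≤mp mn≤A = begin
      fromNat (suc n) * (fromNat (3 ℕ.^ n) * q ^ A)
        ≈⟨ *-assoc _ _ _ ⟨
      fromNat (suc n) * fromNat (3 ℕ.^ n) * q ^ A
        ≈⟨ *-congʳ (fromNat-* (suc n) (3 ℕ.^ n)) ⟨
      fromNat (suc n ℕ.* 3 ℕ.^ n) * q ^ A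
        ≤⟨ *-monoˡ-≤ (^-nonneg 0≤q A) (fromNat-mono-≤ (1+n*3^n≤6^n n)) ⟩
      fromNat (6 ℕ.^ n) * q ^ A
        ≤⟨ *-monoʳ-≤ (0≤fromNat (6 ℕ.^ n)) (^-antitone 0≤q q≤1 mn≤A) ⟩
      fromNat (6 ℕ.^ n) * q ^ (m ℕ.* n)
        ≈⟨ *-cong (fromNat-^ 6 n) (sym (^-assocʳ q m n)) ⟩
      fromNat 6 ^ n * (q ^ m) ^ n
        ≈⟨ Exp.^-distrib-* commutativeSemiring (fromNat 6) (q ^ m) n ⟨
      (fromNat 6 * q ^ m) ^ n
        ≤⟨ ^≤1 (*-nonneg (0≤fromNat 6) (^-nonneg 0≤q m)) 6q^m≤1 n ⟩
      1# ∎
      where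
      open ≤-Reasoning
      6q^m≤1 : fromNat 6 * q ^ m ≤ 1#
      6q^m≤1 = ≤-trans (*-monoˡ-≤ (^-nonneg 0≤q m) (+-monoʳ-≤ 1# 5≤mp)) (bernoulli m)

      1+n*3^n≤6^n : ∀ n → suc n ℕ.* 3 ℕ.^ n ℕ.≤ 6 ℕ.^ n
      1+n*3^n≤6^n zero    = ℕₚ.≤-refl
      1+n*3^n≤6^n (suc n) = ℕₚ.≤-trans (ℕₚ.m≤m+n _ (3 ℕ.* (n ℕ.* t)))
        (ℕₚ.≤-trans (ℕₚ.≤-reflexive (double n t)) (ℕₚ.*-monoʳ-≤ 6 (1+n*3^n≤6^n n)))
        where
        t = 3 ℕ.^ n
        double : ∀ n t → suc (suc n) ℕ.* (3 ℕ.* t) ℕ.+ 3 ℕ.* (n ℕ.* t) ≡ 6 ℕ.* (suc n ℕ.* t)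
        double = solve-∀

integer-√ : ∀ N → ∃[ b ] (b ℕ.* b ℕ.≤ N × N ℕ.≤ suc b ℕ.* suc b)
integer-√ zero = 0 , z≤n , z≤n
integer-√ (suc N) with integer-√ N
... | b , b²≤N , N≤[1+b]² with ℕₚ.m≤n⇒m<n∨m≡n N≤[1+b]²
... | inj₁ N<[1+b]² = b , ℕₚ.m≤n⇒m≤1+n b²≤N , N<[1+b]²
... | inj₂ N≡[1+b]² = suc b , ℕₚ.≤-trans (ℕₚ.≤-reflexive (≡.sym N≡[1+b]²)) (ℕₚ.n≤1+n N) ,
  ℕₚ.≤-trans (ℕₚ.≤-reflexive (≡.cong suc N≡[1+b]²))
    (ℕₚ.*-mono-< (ℕₚ.n<1+n (suc b)) (ℕₚ.n<1+n (suc b)))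

treeWidth≤n : ∀ {n} {G : Graph n} {k} → IsTreeWidth G k → k ℕ.≤ n
treeWidth≤n {n} {G} (_ , minimal) = ℕₚ.≤-trans (minimal (trivialDecomposition G))
  (ℕₚ.≤-trans ℕₚ.pred[n]≤n (ℕₚ.⊔-lub (∣p∣≤n {n} ⊤) z≤n))

-- Probability of a separation and the resulting width

module RandomTreeWidth {c ℓ₁ ℓ₂} (ℝ : RealNumbers c ℓ₁ ℓ₂) where
  open RealNumbers ℝ
  open RandomGraph ℝ
  open OrderedField ℝ

  module BiasedCoin {p : Carrier} (0≤p : 0# ≤ p) (p≤1 : p ≤ 1#) where

    private
      module ≈-Reasoning = SetoidReasoning setoid
      module Solver = NaturalSolver commutativeSemiring
      open Solver using (solve; _:+_; _:*_; _:=_)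

    q : Carrier
    q = 1# - p

    0≤q : 0# ≤ q
    0≤q = ≤-trans (≤-reflexive (sym (-‿inverseʳ p))) (+-monoˡ-≤ (- p) p≤1)

    p+q≈1 : p + q ≈ 1#
    p+q≈1 = trans (+-comm p q) (x-z+z≈x 1# p)

    p*x+q*x≈x : ∀ x → p * x + q * x ≈ x
    p*x+q*x≈x x = trans (sym (distribʳ x p q)) (trans (*-congʳ p+q≈1) (*-identityˡ x))

    𝔼-row-mono : ∀ n {f g : Vec Bool n → Carrier} → (∀ r → f r ≤ g r) → 𝔼-row p n f ≤ 𝔼-row p n g
    𝔼-row-mono zero    f≤g = f≤g []
    𝔼-row-mono (suc n) f≤g = +-mono-≤ (*-monoʳ-≤ 0≤p (𝔼-row-mono n (f≤g ∘ (true ∷_))))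
                                      (*-monoʳ-≤ 0≤q (𝔼-row-mono n (f≤g ∘ (false ∷_))))

    𝔼-row-cong : ∀ n {f g : Vec Bool n → Carrier} → (∀ r → f r ≈ g r) → 𝔼-row p n f ≈ 𝔼-row p n g
    𝔼-row-cong zero    f≈g = f≈g []
    𝔼-row-cong (suc n) f≈g = +-cong (*-congˡ (𝔼-row-cong n (f≈g ∘ (true ∷_))))
                                    (*-congˡ (𝔼-row-cong n (f≈g ∘ (false ∷_))))

    𝔼-row-const : ∀ n x → 𝔼-row p n (λ _ → x) ≈ x
    𝔼-row-const zero    x = refl
    𝔼-row-const (suc n) x =
      trans (+-cong (*-congˡ (𝔼-row-const n x)) (*-congˡ (𝔼-row-const n x))) (p*x+q*x≈x x)

    𝔼-row-+ : ∀ n (f g : Vec Bool n → Carrier) →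
              𝔼-row p n (λ r → f r + g r) ≈ 𝔼-row p n f + 𝔼-row p n g
    𝔼-row-+ zero    f g = refl
    𝔼-row-+ (suc n) f g =
      trans (+-cong (*-congˡ (𝔼-row-+ n _ _)) (*-congˡ (𝔼-row-+ n _ _)))
        (solve 6 (λ p q x y z w →
           p :* (x :+ y) :+ q :* (z :+ w) := (p :* x :+ q :* z) :+ (p :* y :+ q :* w))
           refl p q _ _ _ _)

    𝔼-row-* : ∀ n (f : Vec Bool n → Carrier) x → 𝔼-row p n (λ r → f r * x) ≈ 𝔼-row p n f * x
    𝔼-row-* zero    f x = refl
    𝔼-row-* (suc n) f x =
      trans (+-cong (*-congˡ (𝔼-row-* n _ x)) (*-congˡ (𝔼-row-* n _ x)))
        (solve 5 (λ p q y z x → p :* (y :* x) :+ q :* (z :* x) := (p :* y :+ q :* z) :* x)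
           refl p q _ _ x)

    𝔼-mono : ∀ n {f g : Coins n → Carrier} → (∀ ω → f ω ≤ g ω) → 𝔼 p n f ≤ 𝔼 p n g
    𝔼-mono zero    f≤g = f≤g []
    𝔼-mono (suc n) f≤g = 𝔼-row-mono n (λ r → 𝔼-mono n (f≤g ∘ (r ∷_)))

    𝔼-cong : ∀ n {f g : Coins n → Carrier} → (∀ ω → f ω ≈ g ω) → 𝔼 p n f ≈ 𝔼 p n g
    𝔼-cong zero    f≈g = f≈g []
    𝔼-cong (suc n) f≈g = 𝔼-row-cong n (λ r → 𝔼-cong n (f≈g ∘ (r ∷_)))

    𝔼-const : ∀ n x → 𝔼 p n (λ _ → x) ≈ x
    𝔼-const zero    x = refl
    𝔼-const (suc n) x = trans (𝔼-row-cong n (λ _ → 𝔼-const n x)) (𝔼-row-const n x)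

    𝔼-+ : ∀ n (f g : Coins n → Carrier) → 𝔼 p n (λ ω → f ω + g ω) ≈ 𝔼 p n f + 𝔼 p n g
    𝔼-+ zero    f g = refl
    𝔼-+ (suc n) f g = trans (𝔼-row-cong n (λ r → 𝔼-+ n _ _)) (𝔼-row-+ n _ _)

    [_] : Bool → Carrier
    [ b ] = if b then 1# else 0#

    [_]-nonneg : ∀ b → 0# ≤ [ b ]
    [ true  ]-nonneg = <⇒≤ 0<1
    [ false ]-nonneg = ≤-refl

    [∨]-subadditive : ∀ a b → [ a ∨ b ] ≤ [ a ] + [ b ]
    [∨]-subadditive true  b = x≤x+y 1# [ b ]-nonneg
    [∨]-subadditive false b = ≤-reflexive (sym (+-identityˡ _))

    𝔼-∨ : ∀ n (f g : Coins n → Bool) →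
          𝔼 p n (λ ω → [ f ω ∨ g ω ]) ≤ 𝔼 p n (λ ω → [ f ω ]) + 𝔼 p n (λ ω → [ g ω ])
    𝔼-∨ n f g = ≤-trans (𝔼-mono n (λ ω → [∨]-subadditive (f ω) (g ω))) (≤-reflexive (𝔼-+ n _ _))

    𝔼-∧ : ∀ n b (f : Coins n → Bool) → 𝔼 p n (λ ω → [ b ∧ f ω ]) ≈ [ b ] * 𝔼 p n (λ ω → [ f ω ])
    𝔼-∧ n true  f = sym (*-identityˡ _)
    𝔼-∧ n false f = trans (𝔼-const n 0#) (sym (zeroˡ _))

    𝔼-not : ∀ n (f : Coins n → Bool) → 𝔼 p n (λ ω → [ not (f ω) ]) + 𝔼 p n (λ ω → [ f ω ]) ≈ 1#
    𝔼-not n f = begin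
      𝔼 p n (λ ω → [ not (f ω) ]) + 𝔼 p n (λ ω → [ f ω ])   ≈⟨ 𝔼-+ n _ _ ⟨
      𝔼 p n (λ ω → [ not (f ω) ] + [ f ω ])                 ≈⟨ 𝔼-cong n (λ ω → complement (f ω)) ⟩
      𝔼 p n (λ ω → 1#)                                      ≈⟨ 𝔼-const n 1# ⟩
      1#                                                    ∎
      where
      open ≈-Reasoning
      complement : ∀ b → [ not b ] + [ b ] ≈ 1#
      complement true  = +-identityˡ 1#
      complement false = +-identityʳ 1#

    -- Each coin towards the opposite side must be false and contributes a factor `q`; all other
    -- coins average out.
    rowEmpty-probability : ∀ {n} s (L : Vec Side n) →
      𝔼-row p n (λ r → [ rowEmpty s L (lookup r) ]) ≈ q ^ opposites s L
    rowEmpty-probability left    [] = refl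
    rowEmpty-probability right   [] = refl
    rowEmpty-probability neither [] = refl
    rowEmpty-probability {suc n} s (t ∷ L)
      rewrite opposites-∷ s t L with opposite s t
    ... | false = trans (p*x+q*x≈x _) (rowEmpty-probability s L)
    ... | true  = trans (+-cong (trans (*-congˡ (𝔼-row-const n 0#)) (zeroʳ p))
                                (*-congˡ (rowEmpty-probability s L)))
                        (+-identityˡ _)

    noCrossing-probability : ∀ {n} (L : Vec Side n) →
      𝔼 p n (λ ω → [ noCrossing L (adj (toGraph ω)) ]) ≈ q ^ (lefts L ℕ.* rights L)
    noCrossing-probability         []      = refl
    noCrossing-probability {suc n} (s ∷ L) = begin
      𝔼-row p n (λ r → 𝔼 p n (λ ω → [ rowEmpty s L (lookup r) ∧ E ω ]))
        ≈⟨ 𝔼-row-cong n (λ r → 𝔼-∧ n (rowEmpty s L (lookup r)) E) ⟩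
      𝔼-row p n (λ r → [ rowEmpty s L (lookup r) ] * 𝔼 p n (λ ω → [ E ω ]))
        ≈⟨ 𝔼-row-* n _ _ ⟩
      𝔼-row p n (λ r → [ rowEmpty s L (lookup r) ]) * 𝔼 p n (λ ω → [ E ω ])
        ≈⟨ *-cong (rowEmpty-probability s L) (noCrossing-probability L) ⟩
      q ^ opposites s L * q ^ (lefts L ℕ.* rights L)
        ≈⟨ ^-homo-* q (opposites s L) _ ⟨
      q ^ (opposites s L ℕ.+ lefts L ℕ.* rights L)
        ≡⟨ ≡.cong (q ^_) (lefts*rights-∷ s L) ⟨
      q ^ (lefts (s ∷ L) ℕ.* rights (s ∷ L)) ∎
      where
      open ≈-Reasoning
      E : Coins n → Bool
      E ω = noCrossing L (adj (toGraph ω))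

    -- A labelling that is not large gives the empty event; for a large one the exponent is at least
    -- `a * a`, and `q ≤ 1`.
    large-noCrossing-probability : ∀ {n} a (L : Vec Side n) →
      𝔼 p n (λ ω → [ large a L ∧ noCrossing L (adj (toGraph ω)) ]) ≤ q ^ (a ℕ.* a)
    large-noCrossing-probability {n} a L with large a L | large-sound a L
    ... | false | _     = ≤-trans (≤-reflexive (𝔼-const n 0#)) (^-nonneg 0≤q (a ℕ.* a))
    ... | true  | sound = ≤-trans (≤-reflexive (noCrossing-probability L))
      (^-antitone 0≤q (q≤1 0≤p 0≤q p+q≈1) (ℕₚ.*-mono-≤ (proj₁ (sound tt)) (proj₂ (sound tt))))

    anyLabelling-probability : ∀ {N} n (E : Vec Side n → Coins N → Bool) {x} →
      (∀ L → 𝔼 p N (λ ω → [ E L ω ]) ≤ x) →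
      𝔼 p N (λ ω → [ anyLabelling n (λ L → E L ω) ]) ≤ fromNat (3 ℕ.^ n) * x
    anyLabelling-probability zero E E≤x =
      ≤-trans (E≤x []) (≤-reflexive (sym (trans (*-congʳ (+-identityʳ 1#)) (*-identityˡ _))))
    anyLabelling-probability {N} (suc n) E {x} E≤x = begin
      𝔼 p N (λ ω → [ e left ω ∨ e right ω ∨ e neither ω ])
        ≤⟨ 𝔼-∨ N (e left) (λ ω → e right ω ∨ e neither ω) ⟩
      𝔼 p N (λ ω → [ e left ω ]) + 𝔼 p N (λ ω → [ e right ω ∨ e neither ω ])
        ≤⟨ +-mono-≤ (ih left) (≤-trans (𝔼-∨ N (e right) (e neither))
                                        (+-mono-≤ (ih right) (ih neither))) ⟩
      t * x + (t * x + t * x)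
        ≈⟨ solve 2 (λ t x → t :* x :+ (t :* x :+ t :* x) := (t :+ (t :+ t)) :* x) refl t x ⟩
      (t + (t + t)) * x
        ≈⟨ *-congʳ (+-congˡ (+-congˡ (+-identityʳ t))) ⟨
      (t + (t + (t + 0#))) * x
        ≈⟨ *-congʳ (triple (3 ℕ.^ n)) ⟨
      fromNat (3 ℕ.^ suc n) * x ∎
      where
      open ≤-Reasoning
      t = fromNat (3 ℕ.^ n)
      e : Side → Coins N → Bool
      e s ω = anyLabelling n (λ L → E (s ∷ L) ω)
      ih : ∀ s → 𝔼 p N (λ ω → [ e s ω ]) ≤ t * x
      ih s = anyLabelling-probability n (λ L → E (s ∷ L)) (λ L → E≤x (s ∷ L))
      triple : ∀ m → fromNat (3 ℕ.* m) ≈ fromNat m + (fromNat m + (fromNat m + 0#))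
      triple m = trans (fromNat-+ m _) (+-congˡ (trans (fromNat-+ m _) (+-congˡ (fromNat-+ m 0))))

    separable-probability : ∀ a n →
      Pr p n (λ G → separable a n (adj G)) ≤ fromNat (3 ℕ.^ n) * q ^ (a ℕ.* a)
    separable-probability a n = anyLabelling-probability {n} n
      (λ L ω → large a L ∧ noCrossing L (adj (toGraph ω))) (large-noCrossing-probability a)

    separable-unlikely : ∀ m n a → fromNat 5 ≤ fromNat m * p → m ℕ.* n ℕ.≤ a ℕ.* a →
      fromNat (suc n) * Pr p n (λ G → separable a n (adj G)) ≤ 1#
    separable-unlikely m n a 5≤mp mn≤a² = ≤-trans
      (*-monoʳ-≤ (0≤fromNat (suc n)) (separable-probability a n))
      (union-bound-small 0≤p 0≤q p+q≈1 m n (a ℕ.* a) 5≤mp mn≤a²)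

  -- The vertex sets to be excluded have size a = 1 + b ≈ √(m n) with m ≈ 5/p.
  record Threshold (n : ℕ) (p : Carrier) : Set ℓ₂ where
    field
      m b      : ℕ
      5≤mp     : fromNat 5 ≤ fromNat m * p
      mp≤7     : fromNat m * p ≤ fromNat 7
      b²≤mn    : b ℕ.* b ℕ.≤ m ℕ.* n
      mn≤1+b²  : m ℕ.* n ℕ.≤ suc b ℕ.* suc b

  threshold : ∀ n {p} → 0# < p → p ≤ 1# → Threshold n p
  threshold n 0<p p≤1 with multiple-between 5 0<p p≤1
  ... | m , 5≤mp , mp≤7 with integer-√ (m ℕ.* n)
  ... | b , b²≤mn , mn≤1+b² = record
    { m = m ; b = b ; 5≤mp = 5≤mp ; mp≤7 = mp≤7 ; b²≤mn = b²≤mn ; mn≤1+b² = mn≤1+b² }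

  -- The threshold is a separate parameter because in the theorem it is built from another proof of
  -- positivity than the one inside the quotient.
  module _ {n p} (1≤n : 1 ℕ.≤ n) (0<p : 0# < p) (p≤1 : p ≤ 1#) (θ : Threshold n p) where
    open Threshold θ

    private
      x = fromNat n ÷ p [ 0<p ]

      *-cancelʳ-≤ : ∀ {y z} → y * p ≤ z * p → y ≤ z
      *-cancelʳ-≤ yp≤zp z<y = yp≤zp (*-monoˡ-< 0<p z<y)

      1≤x : 1# ≤ x
      1≤x = *-cancelʳ-≤ (begin
        1# * p       ≈⟨ *-identityˡ p ⟩
        p            ≤⟨ p≤1 ⟩
        1#           ≈⟨ +-identityʳ 1# ⟨
        fromNat 1    ≤⟨ fromNat-mono-≤ 1≤n ⟩
        fromNat n    ≈⟨ ÷-* (fromNat n) 0<p ⟨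
        x * p        ∎)
        where open ≤-Reasoning

      0≤x : 0# ≤ x
      0≤x = ≤-trans (<⇒≤ 0<1) 1≤x

      s = √ x

      0≤s : 0# ≤ s
      0≤s = √-nonneg 0≤x

      1≤s : 1# ≤ s
      1≤s = square-cancel-≤ 0≤s (begin
        1# * 1#  ≈⟨ *-identityˡ 1# ⟩
        1#       ≤⟨ 1≤x ⟩
        x        ≈⟨ √-square 0≤x ⟨
        s * s    ∎)
        where open ≤-Reasoning

      -- Compare squares multiplied by `p`: `b² p ≤ m p n ≤ 7 n ≤ 9 n = (3 s)² p`. The 7 is rounded
      -- up to a square.
      b≤3s : fromNat b ≤ fromNat 3 * s
      b≤3s = square-cancel-≤ (*-nonneg (0≤fromNat 3) 0≤s) (*-cancelʳ-≤ (begin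
        fromNat b * fromNat b * p
          ≈⟨ *-congʳ (fromNat-* b b) ⟨
        fromNat (b ℕ.* b) * p
          ≤⟨ *-monoˡ-≤ (<⇒≤ 0<p) (fromNat-mono-≤ b²≤mn) ⟩
        fromNat (m ℕ.* n) * p
          ≈⟨ *-congʳ (fromNat-* m n) ⟩
        fromNat m * fromNat n * p
          ≈⟨ solve 3 (λ m n p → m :* n :* p := m :* p :* n) refl _ _ p ⟩
        fromNat m * p * fromNat n
          ≤⟨ *-monoˡ-≤ (0≤fromNat n) (≤-trans mp≤7 (fromNat-mono-≤ (ℕₚ.m≤m+n 7 2))) ⟩
        fromNat 9 * fromNat n
          ≈⟨ *-cong (fromNat-* 3 3) (sym (÷-* (fromNat n) 0<p)) ⟩
        fromNat 3 * fromNat 3 * (x * p)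
          ≈⟨ *-congˡ (*-congʳ (√-square 0≤x)) ⟨
        fromNat 3 * fromNat 3 * (s * s * p)
          ≈⟨ solve 3 (λ t s p → t :* t :* (s :* s :* p) := t :* s :* (t :* s) :* p)
               refl _ s p ⟩
        fromNat 3 * s * (fromNat 3 * s) * p ∎))
        where
        open ≤-Reasoning
        open NaturalSolver commutativeSemiring using (solve; _:+_; _:*_; _:=_)

      1+b≤4s : fromNat (suc b) ≤ fromNat 4 * s
      1+b≤4s = ≤-trans (+-mono-≤ 1≤s b≤3s) (≤-reflexive (sym (fromNat-suc-* 3 s)))

    -- The constant is `12 = 3 * 4`: three sets of size `1 + b`, where `b ≤ 3 s` and the 1 is
    -- absorbed by `1 ≤ s`.
    inseparable⇒treeWidth-bound : (G : Graph n) → T (not (separable (suc b) n (adj G))) →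
      ∀ k → IsTreeWidth G k → fromNat n - fromNat 12 * √ (fromNat n ÷ p [ 0<p ]) ≤ fromNat k
    inseparable⇒treeWidth-bound G inseparable k ((D , ≡.refl) , _) = begin
      fromNat n - fromNat 12 * s                        ≤⟨ +-monoˡ-≤ _ n≤k+12s ⟩
      fromNat k + fromNat 12 * s - fromNat 12 * s       ≈⟨ x+z-z≈x (fromNat k) _ ⟩
      fromNat k                                         ∎
      where
      open ≤-Reasoning
      T-not : ∀ {b} → T (not b) → ¬ T b
      T-not {false} _ ()
      n≤k+12s : fromNat n ≤ fromNat k + fromNat 12 * s
      n≤k+12s = begin
        fromNat n
          ≤⟨ fromNat-mono-≤
               (inseparable⇒wide D b (T-not inseparable ∘ separable-complete G)) ⟩
        fromNat (k ℕ.+ (suc b ℕ.+ suc b ℕ.+ suc b))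
          ≡⟨ ≡.cong (λ z → fromNat (k ℕ.+ z)) (triple (suc b)) ⟩
        fromNat (k ℕ.+ 3 ℕ.* suc b)
          ≈⟨ trans (fromNat-+ k _) (+-congˡ (fromNat-* 3 (suc b))) ⟩
        fromNat k + fromNat 3 * fromNat (suc b)
          ≤⟨ +-monoʳ-≤ _ (*-monoʳ-≤ (0≤fromNat 3) 1+b≤4s) ⟩
        fromNat k + fromNat 3 * (fromNat 4 * s)
          ≈⟨ +-congˡ (trans (*-congʳ (fromNat-* 3 4)) (*-assoc _ _ s)) ⟨
        fromNat k + fromNat 12 * s ∎
        where
        triple : ∀ a → a ℕ.+ a ℕ.+ a ≡ 3 ℕ.* a
        triple = solve-∀

mainTheorem3 :
    ∀ {c ℓ₁ ℓ₂} (ℝ : RealNumbers c ℓ₁ ℓ₂) →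
    let open RealNumbers ℝ
        open RandomGraph ℝ in
    (p : ℕ → Carrier) →
    (∀ n → 0# ≤ p n × p n ≤ 1#) →
    (λ n → fromNat n * p n) ⟶∞ →
    Σ[ C ∈ Carrier ] 0# < C ×
      AAS p (λ n G →
        (0<p : 0# < p n) →
        ∀ k → IsTreeWidth G k →
          fromNat n - C * √ (fromNat n ÷ p n [ 0<p ]) ≤ fromNat k
          × fromNat k ≤ fromNat n)
mainTheorem3 ℝ p p∈[0,1] np⟶∞ =
  fromNat 12 , fromNat-mono-< {0} {12} (s≤s z≤n) , (λ n G → event n (N₀ ℕₚ.≤? n) G) ,
  (λ n G → sound n (N₀ ℕₚ.≤? n) G) , likely
  where
  open RealNumbers ℝ
  open RandomGraph ℝ
  open OrderedField ℝ
  open RandomTreeWidth ℝ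

  -- From here on `n p` is positive, which supplies both `1 ≤ n` and `0 < p`.
  N₀ : ℕ
  N₀ = proj₁ (np⟶∞ 0#)

  0<np : ∀ n → N₀ ℕ.≤ n → 0# < fromNat n * p n
  0<np = proj₂ (np⟶∞ 0#)

  1≤n : ∀ n → N₀ ℕ.≤ n → 1 ℕ.≤ n
  1≤n zero    N₀≤n = ⊥-elim (<-irrefl (sym (zeroˡ (p 0))) (0<np 0 N₀≤n))
  1≤n (suc n) N₀≤n = s≤s z≤n

  θ : ∀ n → N₀ ℕ.≤ n → Threshold n (p n)
  θ n N₀≤n = threshold n (fromNat*-positive⁻¹ n (0<np n N₀≤n)) (proj₂ (p∈[0,1] n))

  event : ∀ n → Dec (N₀ ℕ.≤ n) → Graph n → Bool
  event n (yes N₀≤n) G = not (separable (suc (Threshold.b (θ n N₀≤n))) n (adj G))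
  -- The empty event makes soundness vacuous below `N₀`, and the limit ignores these `n`.
  event n (no _)     G = false

  sound : ∀ n d G → T (event n d G) → (0<p : 0# < p n) → ∀ k → IsTreeWidth G k →
          fromNat n - fromNat 12 * √ (fromNat n ÷ p n [ 0<p ]) ≤ fromNat k × fromNat k ≤ fromNat n
  sound n (yes N₀≤n) G G∈A 0<p k k≡tw =
    inseparable⇒treeWidth-bound (1≤n n N₀≤n) 0<p (proj₂ (p∈[0,1] n)) (θ n N₀≤n) G G∈A k k≡tw ,
    fromNat-mono-≤ (treeWidth≤n k≡tw)

  likely : (λ n → Pr (p n) n (event n (N₀ ℕₚ.≤? n))) ⟶ 1#
  likely ε 0<ε with archimedean-* 1# 0<ε
  -- The failure probability is at most `1/(n + 1)`, so `N₁ > 1/ε` brings it below `ε`.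
  ... | N₁ , 1<N₁ε = N₀ ℕ.⊔ N₁ , λ n N≤n → close n (N₀ ℕₚ.≤? n)
          (ℕₚ.≤-trans (ℕₚ.m≤m⊔n N₀ N₁) N≤n) (ℕₚ.≤-trans (ℕₚ.m≤n⊔m N₀ N₁) N≤n)
    where
    close : ∀ n d → N₀ ℕ.≤ n → N₁ ℕ.≤ n →
            1# - ε < Pr (p n) n (event n d) × Pr (p n) n (event n d) < 1# + ε
    close n (no N₀≰n)  N₀≤n N₁≤n = ⊥-elim (N₀≰n N₀≤n)
    close n (yes N₀≤n) _    N₁≤n = lower , upper
      where
      open BiasedCoin (proj₁ (p∈[0,1] n)) (proj₂ (p∈[0,1] n))
      open Threshold (θ n N₀≤n)
      open ≤-Reasoning

      good bad : Carrier
      good = Pr (p n) n (event n (yes N₀≤n))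
      bad  = Pr (p n) n (λ G → separable (suc b) n (adj G))

      good+bad≈1 : good + bad ≈ 1#
      good+bad≈1 = 𝔼-not n (λ ω → separable (suc b) n (adj (toGraph ω)))

      0≤bad : 0# ≤ bad
      0≤bad = ≤-trans (≤-reflexive (sym (𝔼-const n 0#)))
        (𝔼-mono n (λ ω → [ separable (suc b) n (adj (toGraph ω)) ]-nonneg))

      bad<ε : bad < ε
      bad<ε = fromNat*-cancel-< (suc n) (begin-strict
        fromNat (suc n) * bad   ≤⟨ separable-unlikely m n (suc b) 5≤mp mn≤1+b² ⟩
        1#                      <⟨ 1<N₁ε ⟩
        fromNat N₁ * ε          ≤⟨ *-monoˡ-≤ (<⇒≤ 0<ε) (fromNat-mono-≤ (ℕₚ.m≤n⇒m≤1+n N₁≤n)) ⟩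
        fromNat (suc n) * ε     ∎)

      lower : 1# - ε < good
      lower = begin-strict
        1# - ε              ≈⟨ +-congʳ good+bad≈1 ⟨
        good + bad - ε      <⟨ +-monoˡ-< (- ε) (+-monoʳ-< good bad<ε) ⟩
        good + ε - ε        ≈⟨ x+z-z≈x good ε ⟩
        good                ∎

      upper : good < 1# + ε
      upper = begin-strict
        good                ≤⟨ x≤x+y good 0≤bad ⟩
        good + bad          ≈⟨ good+bad≈1 ⟩
        1#                  ≈⟨ +-identityʳ 1# ⟨
        1# + 0#             <⟨ +-monoʳ-< 1# 0<ε ⟩
        1# + ε              ∎
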